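{- The $2$-dimensional Fine $\mathbb{Q}$-codegree spectrum is $$S^F(2)=\left\{\tfrac{2}{k}\;\middle|\;k\in\mathbb{Z}_{>0}\right\}\cup\left\{\tfrac{3}{k}\;\middle|\;k\in\mathbb{Z}_{>0}\right\}.$$
   Context: For a $d$-dimensional rational polytope $P\subseteq\mathbb{R}^d$ and $a\in(\mathbb{Z}^d)^*$ let $h_P(a)=\min_{x\in P}\langle a,x\rangle$. For $s>0$ the Fine adjoint polytope is $P^{F(s)}=\{x\in\mathbb{R}^d : \langle a,x\rangle\ge h_P(a)+s \text{ for all } a\in(\mathbb{Z}^d)^*\setminus\{0\}\}$. The Fine $\mathbb{Q}$-codegree is $\mu^F(P)=(\sup\{s>0 : P^{F(s)}\neq\emptyset\})^{ -1}$. The Fine spectrum in dimension $d$ is $S^F(d)=\{\mu^F(P) : P \text{ a } d\text{ -dimensional lattice polytope}\}$, lattice polytopes being those with vertices in $\mathbb{Z}^d$. -}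

module Defs where

open import Level using (Level; _⊔_; suc)
open import Algebra.Apartness.Bundles using (HeytingCommutativeRing; HeytingField)
open import Algebra.Bundles using (CommutativeRing)
import Algebra.Properties.Monoid.Mult as Mult
open import Data.Integer.Base using (ℤ; +_; -[1+_]; 0ℤ)
import Data.Nat.Base as ℕ
open ℕ using (ℕ)
open import Data.Product.Base using (_×_; ∃; ∃-syntax)
open import Data.Sum.Base using (_⊎_)
open import Data.Vec.Functional using (Vector)
open import Relation.Binary.Core using (Rel)
open import Relation.Binary.PropositionalEquality.Core using (_≡_)
open import Relation.Binary.Structures using (IsStrictPartialOrder)
open import Relation.Nullary.Negation using (¬_)
open import Relation.Unary using (Pred; _∈_)

-- The real numbers, axiomatised as a Cauchy complete Archimedean ordered
-- field.  Classically these axioms determine ℝ up to isomorphism.  The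
-- formulation is constructive (no trichotomy), so that Cauchy reals satisfy
-- it without excluded middle.  Cotransitivity of _<_ follows from that of
-- the apartness relation _#_.
record RealNumbers c ℓ₁ ℓ₂ : Set (suc (c ⊔ ℓ₁ ⊔ ℓ₂)) where
  infix 4 _<_ _≤_
  field
    heytingField : HeytingField c ℓ₁ ℓ₂

  open HeytingField heytingField public
  open HeytingCommutativeRing heytingCommutativeRing public
    using (commutativeRing)
  open CommutativeRing commutativeRing public
    using (+-monoid)

  fromℕ : ℕ → Carrier
  fromℕ n = Mult._×_ +-monoid n 1#

  field
    _<_                    : Rel Carrier ℓ₂
    <-isStrictPartialOrder : IsStrictPartialOrder _≈_ _<_
    #⇒<⊎>                  : ∀ {x y} → x # y → x < y ⊎ y < x
    <⇒#                    : ∀ {x y} → x < y → x # y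
    +-monoˡ-<              : ∀ {x y} z → x < y → x + z < y + z
    *-pos                  : ∀ {x y} → 0# < x → 0# < y → 0# < x * y
    archimedean            : ∀ x → ∃[ n ] x < fromℕ n

  _≤_ : Rel Carrier ℓ₂
  x ≤ y = ¬ (y < x)

  -- The roles of m and n being symmetric, this says |f m - f n| < ε.
  IsCauchy : (ℕ → Carrier) → Set (c ⊔ ℓ₂)
  IsCauchy f = ∀ ε → 0# < ε →
    ∃[ N ] (∀ m n → N ℕ.≤ m → N ℕ.≤ n → f m < f n + ε)

  _ConvergesTo_ : (ℕ → Carrier) → Carrier → Set (c ⊔ ℓ₂)
  f ConvergesTo l = ∀ ε → 0# < ε →
    ∃[ N ] (∀ n → N ℕ.≤ n → f n < l + ε × l < f n + ε)

  field
    cauchyComplete : ∀ f → IsCauchy f → ∃[ l ] f ConvergesTo l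

  fromℤ : ℤ → Carrier
  fromℤ (+ n)    = fromℕ n
  fromℤ -[1+ n ] = - fromℕ (ℕ.suc n)

module Polytopes {c ℓ₁ ℓ₂} (ℝ : RealNumbers c ℓ₁ ℓ₂) where
  open RealNumbers ℝ
  open import Algebra.Properties.Monoid.Sum +-monoid using (sum; sum-syntax)

  private
    variable
      ℓ : Level
      d n : ℕ

  Point : ℕ → Set c
  Point d = Vector Carrier d

  IsSupremum : Pred Carrier ℓ → Carrier → Set (c ⊔ ℓ₂ ⊔ ℓ)
  IsSupremum A σ =
    (∀ s → s ∈ A → s ≤ σ) × (∀ u → (∀ s → s ∈ A → s ≤ u) → σ ≤ u)

  _IsCombinationOf_With_ : Point d → Vector (Point d) n → Vector Carrier n → Set ℓ₁
  _IsCombinationOf_With_ {n = n} x p w =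
    sum w ≈ 1# × (∀ j → x j ≈ ∑[ i < n ] (w i * p i j))

  conv : Vector (Point d) n → Pred (Point d) (c ⊔ ℓ₁ ⊔ ℓ₂)
  conv p x = ∃[ w ] (∀ i → 0# ≤ w i) × x IsCombinationOf p With w

  affineHull : Pred (Point d) ℓ → Pred (Point d) (c ⊔ ℓ₁ ⊔ ℓ)
  affineHull {d = d} P x =
    ∃[ n ] ∃ λ (p : Vector (Point d) n) → (∀ i → p i ∈ P) ×
      ∃[ w ] x IsCombinationOf p With w

  -- dim P = d for P ⊆ ℝᵈ.
  FullDimensional : Pred (Point d) ℓ → Set (c ⊔ ℓ₁ ⊔ ℓ)
  FullDimensional P = ∀ x → x ∈ affineHull P

  -- The lattice polytope spanned by finitely many points of ℤᵈ.  The family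
  -- may have repetitions and points that are not vertices.
  latticePolytope : Vector (Vector ℤ d) n → Pred (Point d) (c ⊔ ℓ₁ ⊔ ℓ₂)
  latticePolytope v = conv (λ i j → fromℤ (v i j))

  -- Elements of (ℤᵈ)* are given by their coordinates in the dual basis.
  ⟨_,_⟩ : Vector ℤ d → Point d → Carrier
  ⟨_,_⟩ {d = d} a x = ∑[ j < d ] (fromℤ (a j) * x j)

  IsNonZero : Vector ℤ d → Set
  IsNonZero a = ¬ (∀ j → a j ≡ 0ℤ)

  -- h = h_P(a), the minimum of ⟨ a , _ ⟩ over P.
  IsSupportValue : Pred (Point d) ℓ → Vector ℤ d → Carrier → Set (c ⊔ ℓ₁ ⊔ ℓ₂ ⊔ ℓ)
  IsSupportValue P a h =
    (∃[ x ] x ∈ P × ⟨ a , x ⟩ ≈ h) × (∀ x → x ∈ P → h ≤ ⟨ a , x ⟩)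

  -- P^{F(s)}
  fineAdjoint : Pred (Point d) ℓ → Carrier → Pred (Point d) (c ⊔ ℓ₁ ⊔ ℓ₂ ⊔ ℓ)
  fineAdjoint P s x = ∀ a → IsNonZero a →
    ∃[ h ] IsSupportValue P a h × h + s ≤ ⟨ a , x ⟩

  -- μ = μ^F(P), i.e. μ is the inverse of the supremum σ.
  IsFineCodegree : Pred (Point d) ℓ → Carrier → Set (c ⊔ ℓ₁ ⊔ ℓ₂ ⊔ ℓ)
  IsFineCodegree P μ =
    ∃[ σ ] IsSupremum (λ s → 0# < s × ∃ (fineAdjoint P s)) σ × μ * σ ≈ 1#

  FineSpectrum : ℕ → Pred Carrier (c ⊔ ℓ₁ ⊔ ℓ₂)
  FineSpectrum d μ = ∃[ n ] ∃ λ (v : Vector (Vector ℤ d) n) →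
    FullDimensional (latticePolytope v) × IsFineCodegree (latticePolytope v) μ

  -- { m / k ∣ k ∈ ℤ, k > 0 }
  PositiveFractions : ℕ → Pred Carrier ℓ₁
  PositiveFractions m q = ∃[ k ] 0 ℕ.< k × q * fromℕ k ≈ fromℕ m

{-# OPTIONS --safe #-}
module Submission where

-- Put g = - h_P, a sublinear function on ℤ², and for x ∈ ℝ² let G = g + ⟨ _ , x ⟩.
-- Then x ∈ P^{F(s)} iff G ≥ s on ℤ² ∖ {0}.  Vectors with sum 0 bound s from above:
-- 2 s ≤ g(a) + g(-a), and 3 s ≤ g(a) + g(b) + g(c) if a + b + c = 0.  Take the
-- smallest of these bounds τ over all bases (a , b) of ℤ², with c = - a - b.  It is
-- attained: if 3 τ = g(a) + g(b) + g(c), choose x with G(a) = G(b) = G(c) = τ; if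
-- 2 τ = g(a) + g(-a), choose x with G(a) = G(-a) = τ, and its other coordinate so that
-- G ≥ τ on ± b + ℤ a.  In both cases minimality of τ and convexity give G ≥ τ on all
-- of ℤ² ∖ {0}.  As g is integral, 2 τ or 3 τ is an integer.
--
-- The minimum over infinitely many bases is only available up to double negation; this
-- suffices because 6 τ, being not not an integer, can be rounded constructively.
--
-- Conversely the triangle with vertices 0, (k , 0), (0 , n) has τ = k / 3 for n = k
-- and τ = k / 2 for n = 2 k.

open import Defs
open import Level using (Level)
open import Relation.Unary using (_≐_; _∪_)

-- Integral sublinear functions on ℤ².

module SublinearFunctions where
  open import Data.Empty using (⊥; ⊥-elim)
  open import Data.Integer.Base
    using (ℤ; +_; -[1+_]; 0ℤ; 1ℤ; -1ℤ; _+_; _*_; _-_; -_; _≤_; ∣_∣; +≤+)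
  import Data.Integer.Properties as ℤ
  open import Data.Integer.Tactic.RingSolver using (solve-∀)
  import Data.Nat.Base as ℕ
  open ℕ using (ℕ; zero; suc)
  open import Data.Integer.DivMod using (_/ℕ_; _%ℕ_; a≡a%ℕn+[a/ℕn]*n; n%ℕd<d)
  import Data.Nat.Properties as ℕ
  open import Data.Nat.Induction using (<-rec)
  open import Data.Product.Base using (_×_; _,_; ∃-syntax; proj₁; proj₂)
  open import Data.Sum.Base using (_⊎_; inj₁; inj₂)
  open import Relation.Binary.PropositionalEquality
    using (_≡_; refl; sym; trans; cong; cong₂; subst; subst₂)
  open import Relation.Nullary.Negation using (¬_)

  infixl 6 _⊞_
  infixl 7 _⊠_

  0≤- : ∀ {i j} → i ≤ j → 0ℤ ≤ j - i
  0≤- = ℤ.i≤j⇒0≤j-i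

  _⊞_ : ∀ {i j} → 0ℤ ≤ i → 0ℤ ≤ j → 0ℤ ≤ i + j
  _⊞_ = ℤ.+-mono-≤

  _⊠_ : ∀ {i} n → 0ℤ ≤ i → 0ℤ ≤ + n * i
  _⊠_ {i} n 0≤i = subst (_≤ + n * i) (ℤ.*-zeroʳ (+ n)) (ℤ.*-monoˡ-≤-nonNeg (+ n) 0≤i)

  -- Linear inequalities are proved by exhibiting j - i as a nonnegative
  -- combination of known nonnegative quantities.
  ≤-by : ∀ {i j t} → j - i ≡ t → 0ℤ ≤ t → i ≤ j
  ≤-by eq 0≤t = ℤ.0≤i-j⇒j≤i (subst (0ℤ ≤_) (sym eq) 0≤t)

  ≤-cancel : ∀ n {i} → 0ℤ ≤ + suc n * i → 0ℤ ≤ i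
  ≤-cancel n {i} p = ℤ.*-cancelˡ-≤-pos 0ℤ i (+ suc n)
    (subst (_≤ + suc n * i) (sym (ℤ.*-zeroʳ (+ suc n))) p)

  -- `P` need not be decidable, so a least element is available only up to double negation: if there
  -- is none, strong induction refutes `P` everywhere.
  least : (P : ℕ → Set) → ∀ {n} → P n → ¬ ¬ (∃[ m ] P m × (∀ k → P k → m ℕ.≤ k))
  least P {n} Pn none = <-rec (λ n → ¬ P n) step n Pn
    where
    step : ∀ n → (∀ {k} → k ℕ.< n → ¬ P k) → ¬ P n
    step n below Pn = none (n , Pn , λ k Pk → ℕ.≮⇒≥ (λ k<n → below k<n Pk))

  ∣≤∣ : ∀ {m i} → 0ℤ ≤ i → m ℕ.≤ ∣ i ∣ → + m ≤ i
  ∣≤∣ 0≤i m≤ = subst (_ ≤_) (ℤ.0≤i⇒+∣i∣≡i 0≤i) (+≤+ m≤)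

  NonZero : ℤ → ℤ → Set
  NonZero p q = ¬ (p ≡ 0ℤ × q ≡ 0ℤ)

  record Sublinear (g : ℤ → ℤ → ℤ) : Set where
    field
      subadditive : ∀ p q r s → g (p + r) (q + s) ≤ g p q + g r s
      homogeneous : ∀ n p q → g (+ n * p) (+ n * q) ≡ + n * g p q

    at-0 : g 0ℤ 0ℤ ≡ 0ℤ
    at-0 = homogeneous 0 0ℤ 0ℤ

    width≥0 : ∀ p q → 0ℤ ≤ g p q + g (- p) (- q)
    width≥0 p q = subst (_≤ g p q + g (- p) (- q))
      (trans (cong₂ g (ℤ.+-inverseʳ p) (ℤ.+-inverseʳ q)) at-0)
      (subadditive p q (- p) (- q))

    triangle≥0 : ∀ p q r s → 0ℤ ≤ g p q + g r s + g (- (p + r)) (- (q + s))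
    triangle≥0 p q r s = ≤-by
      (lin (g p q) (g r s) (g (p + r) (q + s)) (g (- (p + r)) (- (q + s))))
      (0≤- (subadditive p q r s) ⊞ width≥0 (p + r) (q + s))
      where
      lin : ∀ a b c d → (a + b + d) - 0ℤ ≡ (a + b - c) + (c + d)
      lin = solve-∀

  -- This is k (g + ⟨ _ , x ⟩) for the rational point x = (X / k , Y / k); clearing the denominator
  -- keeps all values integral.
  shift : ℕ → ℤ → ℤ → (ℤ → ℤ → ℤ) → ℤ → ℤ → ℤ
  shift k X Y g p q = + k * g p q + (p * X + q * Y)

  shift-sublinear : ∀ {g} → Sublinear g → ∀ k X Y → Sublinear (shift k X Y g)
  shift-sublinear {g} G k X Y = record
    { subadditive = λ p q r s → ≤-by
        (lin (+ k) X Y p q r s (g p q) (g r s) (g (p + r) (q + s)))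
        (k ⊠ 0≤- (subadditive p q r s))
    ; homogeneous = λ n p q → trans
        (cong (λ t → + k * t + (+ n * p * X + + n * q * Y)) (homogeneous n p q))
        (hom (+ k) (+ n) p q X Y (g p q))
    }
    where
    open Sublinear G
    lin : ∀ k X Y p q r s a b c →
      ((k * a + (p * X + q * Y)) + (k * b + (r * X + s * Y)))
        - (k * c + ((p + r) * X + (q + s) * Y)) ≡ k * (a + b - c)
    lin = solve-∀
    hom : ∀ k n p q X Y a →
      k * (n * a) + (n * p * X + n * q * Y) ≡ n * (k * a + (p * X + q * Y))
    hom = solve-∀

  rebase : (a₁ a₂ b₁ b₂ : ℤ) → (ℤ → ℤ → ℤ) → ℤ → ℤ → ℤ
  rebase a₁ a₂ b₁ b₂ g i j = g (i * a₁ + j * b₁) (i * a₂ + j * b₂)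

  rebase-sublinear : ∀ {g} → Sublinear g → ∀ a₁ a₂ b₁ b₂ → Sublinear (rebase a₁ a₂ b₁ b₂ g)
  rebase-sublinear {g} G a₁ a₂ b₁ b₂ = record
    { subadditive = λ p q r s → subst (_≤ g′ p q + g′ r s)
        (cong₂ g (add p q r s a₁ b₁) (add p q r s a₂ b₂))
        (subadditive (p * a₁ + q * b₁) (p * a₂ + q * b₂) (r * a₁ + s * b₁) (r * a₂ + s * b₂))
    ; homogeneous = λ n p q → trans
        (cong₂ g (scale (+ n) p q a₁ b₁) (scale (+ n) p q a₂ b₂))
        (homogeneous n (p * a₁ + q * b₁) (p * a₂ + q * b₂))
    }
    where
    open Sublinear G
    g′ = rebase a₁ a₂ b₁ b₂ g
    add : ∀ p q r s a b → (p * a + q * b) + (r * a + s * b) ≡ (p + r) * a + (q + s) * b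
    add = solve-∀
    scale : ∀ n p q a b → n * p * a + n * q * b ≡ n * (p * a + q * b)
    scale = solve-∀

  -- m stands for a lower bound on 6 τ, so that both kinds of bounds are integral.
  Minimal : ℕ → (ℤ → ℤ → ℤ) → Set
  Minimal m g = ∀ a₁ a₂ b₁ b₂ → a₁ * b₂ - a₂ * b₁ ≡ 1ℤ →
    + m ≤ + 3 * (g a₁ a₂ + g (- a₁) (- a₂)) ×
    + m ≤ + 2 * (g a₁ a₂ + g b₁ b₂ + g (- (a₁ + b₁)) (- (a₂ + b₂)))

  -- Determinants multiply, so a basis in the new coordinates is again a basis in the old ones. This
  -- allows the optimal basis to be taken as the standard one.
  rebase-minimal : ∀ {m g} → Minimal m g → ∀ a₁ a₂ b₁ b₂ → a₁ * b₂ - a₂ * b₁ ≡ 1ℤ →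
    Minimal m (rebase a₁ a₂ b₁ b₂ g)
  rebase-minimal {m} {g} min a₁ a₂ b₁ b₂ det c₁ c₂ d₁ d₂ det′ =
    subst (λ t → + m ≤ + 3 * (g u₁ u₂ + t)) (cong₂ g (opp c₁ c₂ a₁ b₁) (opp c₁ c₂ a₂ b₂)) (proj₁ bounds)
    , subst (λ t → + m ≤ + 2 * (g u₁ u₂ + g v₁ v₂ + t))
        (cong₂ g (opp₂ c₁ c₂ d₁ d₂ a₁ b₁) (opp₂ c₁ c₂ d₁ d₂ a₂ b₂)) (proj₂ bounds)
    where
    u₁ = c₁ * a₁ + c₂ * b₁
    u₂ = c₁ * a₂ + c₂ * b₂
    v₁ = d₁ * a₁ + d₂ * b₁
    v₂ = d₁ * a₂ + d₂ * b₂
    mult : ∀ a₁ a₂ b₁ b₂ c₁ c₂ d₁ d₂ →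
      (c₁ * a₁ + c₂ * b₁) * (d₁ * a₂ + d₂ * b₂) - (c₁ * a₂ + c₂ * b₂) * (d₁ * a₁ + d₂ * b₁)
      ≡ (a₁ * b₂ - a₂ * b₁) * (c₁ * d₂ - c₂ * d₁)
    mult = solve-∀
    bounds = min u₁ u₂ v₁ v₂ (trans (mult a₁ a₂ b₁ b₂ c₁ c₂ d₁ d₂) (cong₂ _*_ det det′))
    opp : ∀ c d a b → - (c * a + d * b) ≡ - c * a + - d * b
    opp = solve-∀
    opp₂ : ∀ c₁ c₂ d₁ d₂ a b →
      - ((c₁ * a + c₂ * b) + (d₁ * a + d₂ * b)) ≡ - (c₁ + d₁) * a + - (c₂ + d₂) * b
    opp₂ = solve-∀

  -- Spreading a lower bound to all nonzero vectors.

  signAbs : ∀ p → ∃[ n ] (p ≡ + n ⊎ p ≡ - (+ n))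
  signAbs (+ n)    = n , inj₁ refl
  signAbs -[1+ n ] = suc n , inj₂ refl

  ray : ∀ {g} → Sublinear g → ∀ T → 0ℤ ≤ T → ∀ x₁ x₂ → T ≤ g x₁ x₂ →
    ∀ n → T ≤ g (+ suc n * x₁) (+ suc n * x₂)
  ray {g} G T 0≤T x₁ x₂ T≤gx n = subst (T ≤_) (sym (homogeneous (suc n) x₁ x₂))
    (≤-by (lin (+ n) T (g x₁ x₂)) (suc n ⊠ 0≤- T≤gx ⊞ n ⊠ 0≤T))
    where
    open Sublinear G
    lin : ∀ n T a → (1ℤ + n) * a - T ≡ (1ℤ + n) * (a - T) + n * T
    lin = solve-∀

  -- With x + y + z = 0, adding m copies of z turns m x - n y into a multiple of - y.
  cone : ∀ {g} → Sublinear g → ∀ T → 0ℤ ≤ T → ∀ x₁ x₂ y₁ y₂ →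
    T ≤ g x₁ x₂ → g (- (x₁ + y₁)) (- (x₂ + y₂)) ≤ T → T ≤ g (- y₁) (- y₂) →
    ∀ m n → ∀ {p q} → p ≡ + m * x₁ - + n * y₁ → q ≡ + m * x₂ - + n * y₂ →
    NonZero p q → T ≤ g p q
  cone {g} G T 0≤T x₁ x₂ y₁ y₂ gx gz g-y zero zero refl refl nz = ⊥-elim (nz (refl , refl))
  cone {g} G T 0≤T x₁ x₂ y₁ y₂ gx gz g-y (suc m) zero refl refl nz = subst (T ≤_)
    (sym (cong₂ g (ℤ.+-identityʳ (+ suc m * x₁)) (ℤ.+-identityʳ (+ suc m * x₂))))
    (ray G T 0≤T x₁ x₂ gx m)
  -- The total (m + suc n) (- y) has value at least (m + suc n) T, of which the m copies of z
  -- account for at most m T. What remains is suc n copies of T, hence at least one.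
  cone {g} G T 0≤T x₁ x₂ y₁ y₂ gx gz g-y m (suc n) {p} {q} refl refl nz = ≤-by
    (lin (+ m) (+ n) T (g p q) (g (- y₁) (- y₂)) (g z₁ z₂))
    (0≤- toMultiple ⊞ m ⊠ 0≤- gz ⊞ (m ℕ.+ suc n) ⊠ 0≤- g-y ⊞ n ⊠ 0≤T)
    where
    open Sublinear G
    z₁ = - (x₁ + y₁)
    z₂ = - (x₂ + y₂)
    sum : ∀ m n x y → (m * x - n * y) + m * - (x + y) ≡ (m + n) * - y
    sum = solve-∀
    toMultiple : + (m ℕ.+ suc n) * g (- y₁) (- y₂) ≤ g p q + + m * g z₁ z₂
    toMultiple = subst₂ (λ s t → s ≤ g p q + t)
      (trans (cong₂ g (sum (+ m) (+ suc n) x₁ y₁) (sum (+ m) (+ suc n) x₂ y₂))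
             (homogeneous (m ℕ.+ suc n) (- y₁) (- y₂)))
      (homogeneous m z₁ z₂)
      (subadditive p q (+ m * z₁) (+ m * z₂))
    lin : ∀ m n T a b c → a - T ≡
      (a + m * c - (m + (1ℤ + n)) * b) + m * (T - c) + (m + (1ℤ + n)) * (b - T) + n * T
    lin = solve-∀

  ℕ-diff : ∀ i j → (∃[ e ] i ≡ j ℕ.+ e) ⊎ (∃[ e ] j ≡ i ℕ.+ e)
  ℕ-diff i j with ℕ.≤-total j i
  ... | inj₁ j≤i = inj₁ (i ℕ.∸ j , sym (ℕ.m+[n∸m]≡n j≤i))
  ... | inj₂ i≤j = inj₂ (j ℕ.∸ i , sym (ℕ.m+[n∸m]≡n i≤j))

  private
    coordinate₁ : ∀ j e → j + e ≡ e * 1ℤ - j * -1ℤ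
    coordinate₁ = solve-∀
    coordinate₂ : ∀ j e → j ≡ e * 0ℤ - j * -1ℤ
    coordinate₂ = solve-∀
    coordinate₃ : ∀ i j → i ≡ i * 1ℤ - j * 0ℤ
    coordinate₃ = solve-∀
    coordinate₄ : ∀ i j → - j ≡ i * 0ℤ - j * 1ℤ
    coordinate₄ = solve-∀
    coordinate₅ : ∀ j e → - (j + e) ≡ j * -1ℤ - e * 1ℤ
    coordinate₅ = solve-∀
    coordinate₆ : ∀ j e → - j ≡ j * -1ℤ - e * 0ℤ
    coordinate₆ = solve-∀

  -- The vectors e₁, e₂, - e₁ - e₂ and their negatives cut the plane into six sectors. Each sector
  -- is spanned by one vector x of the triple and the negative of another one y, so `cone` applies
  -- with the third as z. The signs of p and q, and the larger absolute value if the signs agree,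
  -- select the sector.
  hexagon : ∀ {g} → Sublinear g → ∀ T → 0ℤ ≤ T →
    g 1ℤ 0ℤ ≡ T → g 0ℤ 1ℤ ≡ T → g -1ℤ -1ℤ ≡ T →
    T ≤ g -1ℤ 0ℤ → T ≤ g 0ℤ -1ℤ → T ≤ g 1ℤ 1ℤ →
    ∀ p q → NonZero p q → T ≤ g p q
  hexagon {g} G T 0≤T a b c -a -b -c p q nz with signAbs p | signAbs q
  ... | i , inj₁ refl | j , inj₁ refl with ℕ-diff i j
  ...   | inj₁ (e , refl) = cone G T 0≤T 1ℤ 0ℤ -1ℤ -1ℤ (ℤ.≤-reflexive (sym a)) (ℤ.≤-reflexive b) -c e j
                              (coordinate₁ (+ j) (+ e)) (coordinate₂ (+ j) (+ e)) nz
  ...   | inj₂ (e , refl) = cone G T 0≤T 0ℤ 1ℤ -1ℤ -1ℤ (ℤ.≤-reflexive (sym b)) (ℤ.≤-reflexive a) -c e i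
                              (coordinate₂ (+ i) (+ e)) (coordinate₁ (+ i) (+ e)) nz
  hexagon {g} G T 0≤T a b c -a -b -c p q nz
      | i , inj₁ refl | j , inj₂ refl = cone G T 0≤T 1ℤ 0ℤ 0ℤ 1ℤ (ℤ.≤-reflexive (sym a)) (ℤ.≤-reflexive c) -b i j
                              (coordinate₃ (+ i) (+ j)) (coordinate₄ (+ i) (+ j)) nz
  hexagon {g} G T 0≤T a b c -a -b -c p q nz
      | i , inj₂ refl | j , inj₁ refl = cone G T 0≤T 0ℤ 1ℤ 1ℤ 0ℤ (ℤ.≤-reflexive (sym b)) (ℤ.≤-reflexive c) -a j i
                              (coordinate₄ (+ j) (+ i)) (coordinate₃ (+ j) (+ i)) nz
  hexagon {g} G T 0≤T a b c -a -b -c p q nz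
      | i , inj₂ refl | j , inj₂ refl with ℕ-diff i j
  ...   | inj₁ (e , refl) = cone G T 0≤T -1ℤ -1ℤ 1ℤ 0ℤ (ℤ.≤-reflexive (sym c)) (ℤ.≤-reflexive b) -a j e
                              (coordinate₅ (+ j) (+ e)) (coordinate₆ (+ j) (+ e)) nz
  ...   | inj₂ (e , refl) = cone G T 0≤T -1ℤ -1ℤ 0ℤ 1ℤ (ℤ.≤-reflexive (sym c)) (ℤ.≤-reflexive a) -b i e
                              (coordinate₆ (+ i) (+ e)) (coordinate₅ (+ i) (+ e)) nz

  -- Adding r copies of - e₁, with r the remainder of p modulo suc n, turns the vector into suc n
  -- times a vector of the row σ. The copies cost at most r T, and r ≤ n, so at least one T is left.
  row : ∀ {g} → Sublinear g → ∀ T → 0ℤ ≤ T → ∀ σ → g -1ℤ 0ℤ ≤ T →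
    (∀ k → T ≤ g k σ) → ∀ p n {q} → q ≡ + suc n * σ → T ≤ g p q
  row {g} G T 0≤T σ g-e unit p n refl = ≤-by
    (lin (+ n) (+ r) (+ d) T (g p (N * σ)) (g -1ℤ 0ℤ) (g k σ) (cong +_ r+d≡n))
    (0≤- toMultiple ⊞ r ⊠ 0≤- g-e ⊞ suc n ⊠ 0≤- (unit k) ⊞ d ⊠ 0≤T)
    where
    open Sublinear G
    N = + suc n
    k = p /ℕ suc n
    r = p %ℕ suc n
    d = n ℕ.∸ r
    r+d≡n : r ℕ.+ d ≡ n
    r+d≡n = ℕ.m+[n∸m]≡n (ℕ.s≤s⁻¹ (n%ℕd<d p (suc n)))
    column : ∀ p r k N → p ≡ r + k * N → p + r * -1ℤ ≡ N * k
    column _ r k N refl = ring r k N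
      where
      ring : ∀ r k N → r + k * N + r * -1ℤ ≡ N * k
      ring = solve-∀
    toMultiple : N * g k σ ≤ g p (N * σ) + + r * g -1ℤ 0ℤ
    toMultiple = subst₂ (λ s t → s ≤ g p (N * σ) + t)
      (trans (cong₂ g (column p (+ r) k N (a≡a%ℕn+[a/ℕn]*n p (suc n)))
                      (trans (cong (λ t → N * σ + t) (ℤ.*-zeroʳ (+ r))) (ℤ.+-identityʳ (N * σ))))
             (homogeneous (suc n) k σ))
      (homogeneous r -1ℤ 0ℤ)
      (subadditive p (N * σ) (+ r * -1ℤ) (+ r * 0ℤ))
    lin : ∀ n r d T a b c → r + d ≡ n → a - T ≡
      (a + r * b - (1ℤ + n) * c) + r * (T - b) + (1ℤ + n) * (c - T) + d * T
    lin _ r d T a b c refl = ring r d T a b c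
      where
      ring : ∀ r d T a b c → a - T ≡
        (a + r * b - (1ℤ + (r + d)) * c) + r * (T - b) + (1ℤ + (r + d)) * (c - T) + d * T
      ring = solve-∀

  strip : ∀ {g} → Sublinear g → ∀ T → 0ℤ ≤ T → g 1ℤ 0ℤ ≡ T → g -1ℤ 0ℤ ≡ T →
    (∀ k → T ≤ g k 1ℤ) → (∀ k → T ≤ g k -1ℤ) →
    ∀ p q → NonZero p q → T ≤ g p q
  strip G T 0≤T e -e up down (+ zero) (+ zero) nz = ⊥-elim (nz (refl , refl))
  strip {g} G T 0≤T e -e up down (+ suc n) (+ zero) nz = subst (T ≤_)
    (cong₂ g (ℤ.*-identityʳ (+ suc n)) (ℤ.*-zeroʳ (+ suc n)))
    (ray G T 0≤T 1ℤ 0ℤ (ℤ.≤-reflexive (sym e)) n)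
  strip {g} G T 0≤T e -e up down -[1+ n ] (+ zero) nz = subst (T ≤_)
    (cong₂ g (trans (ℤ.*-comm (+ suc n) -1ℤ) (ℤ.-1*i≡-i (+ suc n))) (ℤ.*-zeroʳ (+ suc n)))
    (ray G T 0≤T -1ℤ 0ℤ (ℤ.≤-reflexive (sym -e)) n)
  strip G T 0≤T e -e up down p (+ suc n) nz =
    row G T 0≤T 1ℤ (ℤ.≤-reflexive -e) up p n (sym (ℤ.*-identityʳ (+ suc n)))
  strip G T 0≤T e -e up down p -[1+ n ] nz =
    row G T 0≤T -1ℤ (ℤ.≤-reflexive -e) down p n
      (sym (trans (ℤ.*-comm (+ suc n) -1ℤ) (ℤ.-1*i≡-i (+ suc n))))

  -- The point (X / k , Y / k) lies in P^{F(T / k)} if g = - h_P.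
  Feasible : (ℤ → ℤ → ℤ) → ℕ → ℤ → Set
  Feasible g k T = ∃[ X ] ∃[ Y ] (∀ p q → NonZero p q → T ≤ shift k X Y g p q)

  -- Feasible points at the minimal value.

  -- X and Y are solved from the requirement that the shifted function be F at e₁ and e₂. It is then
  -- F at - e₁ - e₂ too, since its values on the triple add up to 3 F. At a vector and its negative
  -- the values add up to 3 w for the width w, and 3 w ≥ m = 2 F, so the three opposite vectors also
  -- get at least F.
  minimal-triangle-feasible : ∀ {m g} → Sublinear g → Minimal m g →
    let F = g 1ℤ 0ℤ + g 0ℤ 1ℤ + g -1ℤ -1ℤ in + m ≡ + 2 * F → Feasible g 3 F
  minimal-triangle-feasible {m} {g} G min m≡2F = X , Y ,
    hexagon (shift-sublinear G 3 X Y) F (triangle≥0 1ℤ 0ℤ 0ℤ 1ℤ)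
      (at-e₁ a b F) (at-e₂ a b F) (at-e₃ a b c)
      (half (min₁ a (g -1ℤ 0ℤ) b F) (proj₁ (min 1ℤ 0ℤ 0ℤ 1ℤ refl)))
      (half (min₂ b (g 0ℤ -1ℤ) a F) (proj₁ (min 0ℤ 1ℤ -1ℤ 0ℤ refl)))
      (half (min₃ a b c (g 1ℤ 1ℤ)) (proj₁ (min 1ℤ 1ℤ 0ℤ 1ℤ refl)))
    where
    open Sublinear G
    a = g 1ℤ 0ℤ
    b = g 0ℤ 1ℤ
    c = g -1ℤ -1ℤ
    F = a + b + c
    X = F - + 3 * a
    Y = F - + 3 * b
    half : ∀ {w s} → s - F ≡ + 3 * w - + 2 * F → + m ≤ + 3 * w → F ≤ s
    half {w} eq m≤ = ≤-by eq (0≤- (subst (_≤ + 3 * w) m≡2F m≤))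
    at-e₁ : ∀ a b F → + 3 * a + (1ℤ * (F - + 3 * a) + 0ℤ * (F - + 3 * b)) ≡ F
    at-e₁ = solve-∀
    at-e₂ : ∀ a b F → + 3 * b + (0ℤ * (F - + 3 * a) + 1ℤ * (F - + 3 * b)) ≡ F
    at-e₂ = solve-∀
    at-e₃ : ∀ a b c → + 3 * c + (-1ℤ * (a + b + c - + 3 * a) + -1ℤ * (a + b + c - + 3 * b)) ≡ a + b + c
    at-e₃ = solve-∀
    min₁ : ∀ a a′ b F → + 3 * a′ + (-1ℤ * (F - + 3 * a) + 0ℤ * (F - + 3 * b)) - F
      ≡ + 3 * (a + a′) - + 2 * F
    min₁ = solve-∀
    min₂ : ∀ b b′ a F → + 3 * b′ + (0ℤ * (F - + 3 * a) + -1ℤ * (F - + 3 * b)) - F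
      ≡ + 3 * (b + b′) - + 2 * F
    min₂ = solve-∀
    min₃ : ∀ a b c c′ → + 3 * c′ + (1ℤ * (a + b + c - + 3 * a) + 1ℤ * (a + b + c - + 3 * b)) - (a + b + c)
      ≡ + 3 * (c′ + c) - + 2 * (a + b + c)
    min₃ = solve-∀

  -- X makes the shifted function equal to T at both e₁ and - e₁. On the rows (k , 1) and (l , -1)
  -- the bound T then reads `L k` ≤ Y and Y ≤ `U l`. As every `L k` lies below every `U l`, the
  -- largest `L k` serves as Y.
  minimal-width-feasible : ∀ {m g} → Sublinear g → Minimal m g →
    let T = g 1ℤ 0ℤ + g -1ℤ 0ℤ in + m ≡ + 3 * T → ¬ ¬ Feasible g 2 T
  minimal-width-feasible {m} {g} G min m≡3T infeasible =
    -- Maximising `L k` means minimising the natural number `U 0ℤ - L k`; the index 0 starts the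
    -- search.
    least P {∣ U 0ℤ - L 0ℤ ∣} (0ℤ , ℤ.0≤i⇒+∣i∣≡i (0≤- (L≤U 0ℤ 0ℤ))) λ (n , (k₀ , n≡) , n≤) →
      let Y = L k₀
          L≤Y : ∀ k → L k ≤ Y
          L≤Y k = ≤-by (swap (U 0ℤ) (L k) (L k₀)) (0≤- (subst (_≤ U 0ℤ - L k) n≡
            (∣≤∣ (0≤- (L≤U k 0ℤ)) (n≤ ∣ U 0ℤ - L k ∣ (k , ℤ.0≤i⇒+∣i∣≡i (0≤- (L≤U k 0ℤ)))))))
      in infeasible (X , Y , strip (shift-sublinear G 2 X Y) T 0≤T
           (at-e a a′ Y) (at--e a a′ Y)
           (λ k → ≤-by (upper T (g k 1ℤ) k X Y) (0≤- (L≤Y k)))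
           (λ k → ≤-by (lower T (g k -1ℤ) k X Y) (0≤- (L≤U k₀ k))))
    where
    open Sublinear G
    a = g 1ℤ 0ℤ
    a′ = g -1ℤ 0ℤ
    T = a + a′
    X = T - + 2 * a
    L U : ℤ → ℤ
    L k = T - + 2 * g k 1ℤ - k * X
    U l = + 2 * g l -1ℤ + l * X - T
    P : ℕ → Set
    P n = ∃[ k ] + n ≡ U 0ℤ - L k
    0≤T : 0ℤ ≤ T
    0≤T = width≥0 1ℤ 0ℤ
    swap : ∀ u s t → t - s ≡ (u - s) - (u - t)
    swap = solve-∀
    at-e : ∀ a a′ Y → + 2 * a + (1ℤ * (a + a′ - + 2 * a) + 0ℤ * Y) ≡ a + a′
    at-e = solve-∀
    at--e : ∀ a a′ Y → + 2 * a′ + (-1ℤ * (a + a′ - + 2 * a) + 0ℤ * Y) ≡ a + a′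
    at--e = solve-∀
    upper : ∀ T b k X Y → + 2 * b + (k * X + 1ℤ * Y) - T ≡ Y - (T - + 2 * b - k * X)
    upper = solve-∀
    lower : ∀ T b k X Y → + 2 * b + (k * X + -1ℤ * Y) - T ≡ (+ 2 * b + k * X - T) - Y
    lower = solve-∀
    width≥T : ∀ {w} → + m ≤ + 3 * w → 0ℤ ≤ w - T
    width≥T {w} m≤ = ≤-cancel 2 (subst (0ℤ ≤_) (lin w T) (0≤- (subst (_≤ + 3 * w) m≡3T m≤)))
      where
      lin : ∀ w T → + 3 * w - + 3 * T ≡ + 3 * (w - T)
      lin = solve-∀
    triangle≥T : ∀ {f} → + m ≤ + 2 * f → 0ℤ ≤ + 2 * f - + 3 * T
    triangle≥T {f} m≤ = 0≤- (subst (_≤ + 2 * f) m≡3T m≤)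
    det : ∀ k → k * 0ℤ - 1ℤ * -1ℤ ≡ 1ℤ
    det = solve-∀
    horizontal : ∀ n σ k → + n * g σ 0ℤ ≤ g k 1ℤ + g (+ n * σ - k) -1ℤ
    horizontal n σ k = subst (_≤ g k 1ℤ + g (+ n * σ - k) -1ℤ)
      (trans (cong₂ g (sum (+ n * σ) k) (sym (ℤ.*-zeroʳ (+ n)))) (homogeneous n σ 0ℤ))
      (subadditive k 1ℤ (+ n * σ - k) -1ℤ)
      where
      sum : ∀ D k → k + (D - k) ≡ D
      sum = solve-∀
    -- The vectors (k , 1) and (D - k , -1) add up to (D , 0). For D = 0 they are antipodal and the
    -- width bound applies; for D = ± 1 they form a triple with ∓ e₁ and the triangle bound applies.
    -- For larger absolute values of D, subadditivity along the first axis gives the inequality with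
    -- a surplus of (∣ D ∣ - 2) T ≥ 0.
    L≤U-sum : ∀ D k → L k ≤ U (D - k)
    L≤U-sum (+ 0) k = ≤-by
      (lin (g k 1ℤ) (g (0ℤ - k) -1ℤ) k X T)
      (2 ⊠ subst (λ t → 0ℤ ≤ g k 1ℤ + g t -1ℤ - T) (sym (ℤ.+-identityˡ (- k)))
        (width≥T (proj₁ (min k 1ℤ -1ℤ 0ℤ (det k)))))
      where
      lin : ∀ b b′ k X T → (+ 2 * b′ + (0ℤ - k) * X - T) - (T - + 2 * b - k * X)
        ≡ + 2 * (b + b′ - T)
      lin = solve-∀
    L≤U-sum (+ 1) k = ≤-by
      (lin (g k 1ℤ) (g (1ℤ - k) -1ℤ) k a a′)
      (triangle≥T (subst (λ t → + m ≤ + 2 * (g k 1ℤ + a′ + g t -1ℤ)) (opp k)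
        (proj₂ (min k 1ℤ -1ℤ 0ℤ (det k)))))
      where
      opp : ∀ k → - (k + -1ℤ) ≡ 1ℤ - k
      opp = solve-∀
      lin : ∀ b b′ k a a′ → (+ 2 * b′ + (1ℤ - k) * (a + a′ - + 2 * a) - (a + a′))
          - (a + a′ - + 2 * b - k * (a + a′ - + 2 * a))
        ≡ + 2 * (b + a′ + b′) - + 3 * (a + a′)
      lin = solve-∀
    L≤U-sum -[1+ 0 ] k = ≤-by
      (lin (g k 1ℤ) (g (-1ℤ - k) -1ℤ) k a a′)
      (triangle≥T (subst (λ t → + m ≤ + 2 * (a + g k 1ℤ + g t -1ℤ)) (opp k)
        (proj₂ (min 1ℤ 0ℤ k 1ℤ refl))))
      where
      opp : ∀ k → - (1ℤ + k) ≡ -1ℤ - k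
      opp = solve-∀
      lin : ∀ b b′ k a a′ → (+ 2 * b′ + (-1ℤ - k) * (a + a′ - + 2 * a) - (a + a′))
          - (a + a′ - + 2 * b - k * (a + a′ - + 2 * a))
        ≡ + 2 * (a + b + b′) - + 3 * (a + a′)
      lin = solve-∀
    L≤U-sum (+ suc (suc n)) k = subst (λ D → L k ≤ U (D - k)) (ℤ.*-identityʳ (+ suc (suc n))) (≤-by
      (lin (g k 1ℤ) (g (+ suc (suc n) * 1ℤ - k) -1ℤ) k a a′ (+ n))
      (2 ⊠ 0≤- (horizontal (suc (suc n)) 1ℤ k) ⊞ n ⊠ 0≤T))
      where
      lin : ∀ b b′ k a a′ n → (+ 2 * b′ + ((+ 2 + n) * 1ℤ - k) * (a + a′ - + 2 * a) - (a + a′))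
          - (a + a′ - + 2 * b - k * (a + a′ - + 2 * a))
        ≡ + 2 * (b + b′ - (+ 2 + n) * a) + n * (a + a′)
      lin = solve-∀
    L≤U-sum -[1+ suc n ] k = subst (λ D → L k ≤ U (D - k))
      (trans (ℤ.*-comm (+ suc (suc n)) -1ℤ) (ℤ.-1*i≡-i (+ suc (suc n)))) (≤-by
      (lin (g k 1ℤ) (g (+ suc (suc n) * -1ℤ - k) -1ℤ) k a a′ (+ n))
      (2 ⊠ 0≤- (horizontal (suc (suc n)) -1ℤ k) ⊞ n ⊠ 0≤T))
      where
      lin : ∀ b b′ k a a′ n → (+ 2 * b′ + ((+ 2 + n) * -1ℤ - k) * (a + a′ - + 2 * a) - (a + a′))
          - (a + a′ - + 2 * b - k * (a + a′ - + 2 * a))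
        ≡ + 2 * (b + b′ - (+ 2 + n) * a′) + n * (a + a′)
      lin = solve-∀
    L≤U : ∀ k l → L k ≤ U l
    L≤U k l = subst (λ t → L k ≤ U t) (sum k l) (L≤U-sum (k + l) k)
      where
      sum : ∀ k l → k + l - k ≡ l
      sum = solve-∀

  -- Members of a certificate sum to zero, so adding up the inequalities
  -- - g a + s ≤ ⟨ a , x ⟩ over them gives k s ≤ T.
  data Certificate (g : ℤ → ℤ → ℤ) : ℕ → ℤ → Set where
    antipodal  : ∀ {T} p q → NonZero p q → g p q + g (- p) (- q) ≤ T → Certificate g 2 T
    triangular : ∀ {T} p q r s → NonZero p q → NonZero r s → NonZero (- (p + r)) (- (q + s)) →
                 g p q + g r s + g (- (p + r)) (- (q + s)) ≤ T → Certificate g 3 T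

  -- A basis attaining the least value exists up to double negation. The bound attained there
  -- supplies the certificate; after moving this basis to the standard one, the matching feasibility
  -- lemma supplies a point, which is carried back.
  optimum : ∀ {g} → Sublinear g → ¬ ¬ (∃[ k ] ∃[ T ] Certificate g k T × Feasible g k T)
  optimum {g} G none = least Value {∣ + 3 * (g 1ℤ 0ℤ + g -1ℤ 0ℤ) ∣}
      (1ℤ , 0ℤ , 0ℤ , 1ℤ , refl , inj₁ (ℤ.0≤i⇒+∣i∣≡i (3 ⊠ width≥0 1ℤ 0ℤ)))
      λ (m , value , m≤) → conclude m value (minimal m m≤)
    where
    open Sublinear G
    Value : ℕ → Set
    Value m = ∃[ a₁ ] ∃[ a₂ ] ∃[ b₁ ] ∃[ b₂ ] a₁ * b₂ - a₂ * b₁ ≡ 1ℤ ×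
      (+ m ≡ + 3 * (g a₁ a₂ + g (- a₁) (- a₂)) ⊎
       + m ≡ + 2 * (g a₁ a₂ + g b₁ b₂ + g (- (a₁ + b₁)) (- (a₂ + b₂))))
    minimal : ∀ m → (∀ n → Value n → m ℕ.≤ n) → Minimal m g
    minimal m m≤ a₁ a₂ b₁ b₂ det =
        ∣≤∣ 0≤3w (m≤ _ (a₁ , a₂ , b₁ , b₂ , det , inj₁ (ℤ.0≤i⇒+∣i∣≡i 0≤3w)))
      , ∣≤∣ 0≤2f (m≤ _ (a₁ , a₂ , b₁ , b₂ , det , inj₂ (ℤ.0≤i⇒+∣i∣≡i 0≤2f)))
      where
      0≤3w = 3 ⊠ width≥0 a₁ a₂
      0≤2f = 2 ⊠ triangle≥0 a₁ a₂ b₁ b₂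
    conclude : ∀ m → Value m → Minimal m g → ⊥
    conclude m (a₁ , a₂ , b₁ , b₂ , det , value) min = cases value
      where
      g′ = rebase a₁ a₂ b₁ b₂ g
      G′ = rebase-sublinear G a₁ a₂ b₁ b₂
      min′ = rebase-minimal {g = g} min a₁ a₂ b₁ b₂ det
      nonZero : ∀ c₁ c₂ d₁ d₂ → c₁ * d₂ - c₂ * d₁ ≡ 1ℤ → NonZero c₁ c₂
      nonZero c₁ c₂ d₁ d₂ det′ (refl , refl) with () ← det′
      first : ∀ a b → 1ℤ * a + 0ℤ * b ≡ a
      first = solve-∀
      second : ∀ a b → 0ℤ * a + 1ℤ * b ≡ b
      second = solve-∀
      opp : ∀ a b → -1ℤ * a + 0ℤ * b ≡ - a
      opp = solve-∀
      third : ∀ a b → -1ℤ * a + -1ℤ * b ≡ - (a + b)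
      third = solve-∀
      g-first : g′ 1ℤ 0ℤ ≡ g a₁ a₂
      g-first = cong₂ g (first a₁ b₁) (first a₂ b₂)
      g-second : g′ 0ℤ 1ℤ ≡ g b₁ b₂
      g-second = cong₂ g (second a₁ b₁) (second a₂ b₂)
      g-opp : g′ -1ℤ 0ℤ ≡ g (- a₁) (- a₂)
      g-opp = cong₂ g (opp a₁ b₁) (opp a₂ b₂)
      g-third : g′ -1ℤ -1ℤ ≡ g (- (a₁ + b₁)) (- (a₂ + b₂))
      g-third = cong₂ g (third a₁ b₁) (third a₂ b₂)
      unrebase : ∀ k {T} → Feasible g′ k T → Feasible g k T
      unrebase k {T} (X , Y , T≤) =
        -- Cramer's rule with determinant 1 gives (p , q) = i a + j b. The transported point is the
        -- one whose pairing with (p , q) is i X + j Y.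
        b₂ * X - a₂ * Y , a₁ * Y - b₁ * X , λ p q nz →
        let i = p * b₂ - q * b₁
            j = q * a₁ - p * a₂
            inv₁ : i * a₁ + j * b₁ ≡ p
            inv₁ = trans (ring₁ p q a₁ a₂ b₁ b₂) (trans (cong (p *_) det) (ℤ.*-identityʳ p))
            inv₂ : i * a₂ + j * b₂ ≡ q
            inv₂ = trans (ring₂ p q a₁ a₂ b₁ b₂) (trans (cong (q *_) det) (ℤ.*-identityʳ q))
        in subst (T ≤_) (cong₂ (λ s t → + k * s + t) (cong₂ g inv₁ inv₂) (pairing p q a₁ a₂ b₁ b₂ X Y))
             (T≤ i j λ (i≡0 , j≡0) → nz
               ( trans (sym inv₁) (cong₂ (λ s t → s * a₁ + t * b₁) i≡0 j≡0)
               , trans (sym inv₂) (cong₂ (λ s t → s * a₂ + t * b₂) i≡0 j≡0)))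
        where
        ring₁ : ∀ p q a₁ a₂ b₁ b₂ →
          (p * b₂ - q * b₁) * a₁ + (q * a₁ - p * a₂) * b₁ ≡ p * (a₁ * b₂ - a₂ * b₁)
        ring₁ = solve-∀
        ring₂ : ∀ p q a₁ a₂ b₁ b₂ →
          (p * b₂ - q * b₁) * a₂ + (q * a₁ - p * a₂) * b₂ ≡ q * (a₁ * b₂ - a₂ * b₁)
        ring₂ = solve-∀
        pairing : ∀ p q a₁ a₂ b₁ b₂ X Y →
          (p * b₂ - q * b₁) * X + (q * a₁ - p * a₂) * Y
          ≡ p * (b₂ * X - a₂ * Y) + q * (a₁ * Y - b₁ * X)
        pairing = solve-∀
      -- The pairs (b , - a) and (- (a + b) , a) are bases as well, so `nonZero` covers all three
      -- members of the certificate.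
      rotate : ∀ a₁ a₂ b₁ b₂ → b₁ * (- a₂) - b₂ * (- a₁) ≡ a₁ * b₂ - a₂ * b₁
      rotate = solve-∀
      rotate₂ : ∀ a₁ a₂ b₁ b₂ → - (a₁ + b₁) * a₂ - - (a₂ + b₂) * a₁ ≡ a₁ * b₂ - a₂ * b₁
      rotate₂ = solve-∀
      cases : _ → ⊥
      cases (inj₁ m≡3w) = minimal-width-feasible G′ min′ (trans m≡3w (cong (+ 3 *_) (sym T≡))) λ feasible →
        none (2 , _ ,
          antipodal a₁ a₂ (nonZero a₁ a₂ b₁ b₂ det) (ℤ.≤-reflexive (sym T≡)) ,
          unrebase 2 feasible)
        where T≡ = cong₂ _+_ g-first g-opp
      cases (inj₂ m≡2f) = none (3 , _ ,
          triangular a₁ a₂ b₁ b₂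
            (nonZero a₁ a₂ b₁ b₂ det)
            (nonZero b₁ b₂ (- a₁) (- a₂) (trans (rotate a₁ a₂ b₁ b₂) det))
            (nonZero (- (a₁ + b₁)) (- (a₂ + b₂)) a₁ a₂ (trans (rotate₂ a₁ a₂ b₁ b₂) det))
            (ℤ.≤-reflexive (sym F≡)) ,
          unrebase 3 (minimal-triangle-feasible G′ min′ (trans m≡2f (cong (+ 2 *_) (sym F≡)))))
        where F≡ = cong₂ _+_ (cong₂ _+_ g-first g-second) g-third

-- Constructive arithmetic and order in the real field.

module OrderedField {c ℓ₁ ℓ₂} (ℝ : RealNumbers c ℓ₁ ℓ₂) where
  open RealNumbers ℝ renaming (refl to ≈-refl; sym to ≈-sym; trans to ≈-trans; reflexive to ≈-reflexive)
  open import Algebra.Bundles using (CommutativeRing)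
  open import Algebra.Apartness.Properties.HeytingCommutativeRing heytingCommutativeRing
    using (1#0; x-0≈x)
  private module CR = CommutativeRing commutativeRing
  open import Algebra.Properties.Ring CR.ring
    using (-0#≈0#; -‿involutive; -‿distribˡ-*; -‿distribʳ-*; -‿+-comm)
  open import Algebra.Properties.Semiring.Mult CR.semiring
    using (×1-homo-*; ×-homo-+; ×-homo-1)
  open import Algebra.Solver.Ring.AlmostCommutativeRing
    using (AlmostCommutativeRing; fromCommutativeRing; _-Raw-AlmostCommutative⟶_)
  import Algebra.Solver.Ring
  open import Data.Empty using (⊥-elim)
  open import Data.Integer.Base as ℤ using (ℤ; +_; -[1+_]; 0ℤ; 1ℤ; _⊖_)
  import Data.Integer.Properties as ℤ
  open import Data.Integer.Tactic.RingSolver using (solve-∀)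
  open import Data.Maybe.Base using (Maybe; just; nothing)
  open import Data.Nat.Base as ℕ using (ℕ; zero; suc)
  import Data.Nat.Properties as ℕ
  open import Data.Product.Base using (_×_; _,_; ∃-syntax; proj₁; proj₂)
  import Data.Sign.Base as Sign
  open import Data.Sum.Base using (_⊎_; inj₁; inj₂; [_,_]′)
  open import Relation.Binary.PropositionalEquality as ≡ using (_≡_; cong)
  open import Relation.Binary.Structures using (IsStrictPartialOrder)
  open import Relation.Nullary.Decidable using (yes; no)
  open import Relation.Nullary.Negation using (¬_)
  open IsStrictPartialOrder <-isStrictPartialOrder
    using (<-resp-≈) renaming (irrefl to <-irrefl; trans to <-trans)
  open import Relation.Binary.Reasoning.Setoid CR.setoid

  -- Integer coefficients

  fromℤ-neg : ∀ n → fromℤ (ℤ.- (+ n)) ≈ - fromℕ n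
  fromℤ-neg zero    = ≈-sym -0#≈0#
  fromℤ-neg (suc n) = ≈-refl

  fromℤ-⊖ : ∀ m n → fromℤ (m ⊖ n) ≈ fromℕ m + - fromℕ n
  fromℤ-⊖ m zero = ≈-sym (≈-trans (+-congˡ -0#≈0#) (+-identityʳ _))
  fromℤ-⊖ zero (suc n) = ≈-sym (+-identityˡ _)
  fromℤ-⊖ (suc m) (suc n) = begin
    fromℤ (suc m ⊖ suc n)                  ≡⟨ cong fromℤ (ℤ.[1+m]⊖[1+n]≡m⊖n m n) ⟩
    fromℤ (m ⊖ n)                          ≈⟨ fromℤ-⊖ m n ⟩
    x + - y                                ≈⟨ +-congʳ (+-identityʳ x) ⟨
    (x + 0#) + - y                         ≈⟨ +-congʳ (+-congˡ (-‿inverseʳ 1#)) ⟨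
    (x + (1# + - 1#)) + - y                ≈⟨ +-congʳ (+-assoc x 1# (- 1#)) ⟨
    ((x + 1#) + - 1#) + - y                ≈⟨ +-assoc _ _ _ ⟩
    (x + 1#) + (- 1# + - y)                ≈⟨ +-cong (+-comm x 1#) (-‿+-comm 1# y) ⟩
    fromℕ (suc m) + - fromℕ (suc n)        ∎
    where
    x = fromℕ m
    y = fromℕ n

  fromℕ-+ : ∀ m n → fromℕ (m ℕ.+ n) ≈ fromℕ m + fromℕ n
  fromℕ-+ = ×-homo-+ 1#

  fromℤ-+ : ∀ i j → fromℤ (i ℤ.+ j) ≈ fromℤ i + fromℤ j
  fromℤ-+ (+ m) (+ n) = fromℕ-+ m n
  fromℤ-+ (+ m) -[1+ n ] = fromℤ-⊖ m (suc n)
  fromℤ-+ -[1+ m ] (+ n) = ≈-trans (fromℤ-⊖ n (suc m)) (+-comm _ _)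
  fromℤ-+ -[1+ m ] -[1+ n ] = begin
    - fromℕ (suc (suc (m ℕ.+ n)))       ≡⟨ cong (λ k → - fromℕ (suc k)) (ℕ.+-suc m n) ⟨
    - fromℕ (suc m ℕ.+ suc n)           ≈⟨ -‿cong (fromℕ-+ (suc m) (suc n)) ⟩
    - (fromℕ (suc m) + fromℕ (suc n))   ≈⟨ -‿+-comm _ _ ⟨
    - fromℕ (suc m) + - fromℕ (suc n)   ∎

  fromℤ-- : ∀ i → fromℤ (ℤ.- i) ≈ - fromℤ i
  fromℤ-- (+ n)    = fromℤ-neg n
  fromℤ-- -[1+ n ] = ≈-sym (-‿involutive _)

  fromℤ-* : ∀ i j → fromℤ (i ℤ.* j) ≈ fromℤ i * fromℤ j
  fromℤ-* (+ m) (+ n) = ≈-trans (≈-reflexive (cong fromℤ (ℤ.+◃n≡+n (m ℕ.* n)))) (×1-homo-* m n)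
  fromℤ-* (+ m) -[1+ n ] = begin
    fromℤ (Sign.- ℤ.◃ m ℕ.* suc n)   ≡⟨ cong fromℤ (ℤ.-◃n≡-n (m ℕ.* suc n)) ⟩
    fromℤ (ℤ.- (+ (m ℕ.* suc n)))    ≈⟨ fromℤ-neg (m ℕ.* suc n) ⟩
    - fromℕ (m ℕ.* suc n)            ≈⟨ -‿cong (×1-homo-* m (suc n)) ⟩
    - (fromℕ m * fromℕ (suc n))      ≈⟨ -‿distribʳ-* _ _ ⟩
    fromℕ m * - fromℕ (suc n)        ∎
  fromℤ-* -[1+ m ] (+ n) = begin
    fromℤ (Sign.- ℤ.◃ suc m ℕ.* n)   ≡⟨ cong fromℤ (ℤ.-◃n≡-n (suc m ℕ.* n)) ⟩
    fromℤ (ℤ.- (+ (suc m ℕ.* n)))    ≈⟨ fromℤ-neg (suc m ℕ.* n) ⟩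
    - fromℕ (suc m ℕ.* n)            ≈⟨ -‿cong (×1-homo-* (suc m) n) ⟩
    - (fromℕ (suc m) * fromℕ n)      ≈⟨ -‿distribˡ-* _ _ ⟩
    - fromℕ (suc m) * fromℕ n        ∎
  fromℤ-* -[1+ m ] -[1+ n ] = begin
    fromℕ (suc m ℕ.* suc n)              ≈⟨ ×1-homo-* (suc m) (suc n) ⟩
    fromℕ (suc m) * fromℕ (suc n)        ≈⟨ -‿involutive _ ⟨
    - - (fromℕ (suc m) * fromℕ (suc n))  ≈⟨ -‿cong (-‿distribʳ-* _ _) ⟩
    - (fromℕ (suc m) * - fromℕ (suc n))  ≈⟨ -‿distribˡ-* _ _ ⟩
    - fromℕ (suc m) * - fromℕ (suc n)    ∎

  private
    almostCommutativeRing : AlmostCommutativeRing _ _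
    almostCommutativeRing = fromCommutativeRing commutativeRing

    fromℤ-morphism : ℤ.+-*-rawRing -Raw-AlmostCommutative⟶ almostCommutativeRing
    fromℤ-morphism = record
      { ⟦_⟧    = fromℤ
      ; +-homo = fromℤ-+
      ; *-homo = fromℤ-*
      ; -‿homo = fromℤ--
      ; 0-homo = ≈-refl
      ; 1-homo = ×-homo-1 1#
      }

    _coeff≟_ : ∀ i j → Maybe (fromℤ i ≈ fromℤ j)
    i coeff≟ j with i ℤ.≟ j
    ... | yes i≡j = just (≈-reflexive (cong fromℤ i≡j))
    ... | no  _   = nothing

  -- Coefficients are taken in ℤ, where equality is decidable, and interpreted through `fromℤ`.
  open Algebra.Solver.Ring ℤ.+-*-rawRing almostCommutativeRing fromℤ-morphism _coeff≟_ public
    using (solve; _:=_; _:+_; _:*_; _:-_; :-_; con)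

  -- Order

  <-respʳ : ∀ {x y z} → y ≈ z → x < y → x < z
  <-respʳ = proj₁ <-resp-≈

  <-respˡ : ∀ {x y z} → y ≈ z → y < x → z < x
  <-respˡ = proj₂ <-resp-≈

  <-cotrans : ∀ {x y} → x < y → ∀ z → x < z ⊎ z < y
  <-cotrans x<y z with #-cotrans (<⇒# x<y) z
  ... | inj₁ x#z = [ inj₁ , (λ z<x → inj₂ (<-trans z<x x<y)) ]′ (#⇒<⊎> x#z)
  ... | inj₂ z#y = [ inj₂ , (λ y<z → inj₁ (<-trans x<y y<z)) ]′ (#⇒<⊎> z#y)

  <⇒≤ : ∀ {x y} → x < y → x ≤ y
  <⇒≤ x<y y<x = <-irrefl ≈-refl (<-trans x<y y<x)

  ≤-reflexive : ∀ {x y} → x ≈ y → x ≤ y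
  ≤-reflexive x≈y y<x = <-irrefl (≈-sym x≈y) y<x

  ≤-trans : ∀ {x y z} → x ≤ y → y ≤ z → x ≤ z
  ≤-trans x≤y y≤z z<x = [ y≤z , x≤y ]′ (<-cotrans z<x _)

  <-≤-trans : ∀ {x y z} → x < y → y ≤ z → x < z
  <-≤-trans {z = z} x<y y≤z = [ (λ x<z → x<z) , (λ z<y → ⊥-elim (y≤z z<y)) ]′ (<-cotrans x<y z)

  ≤-antisym : ∀ {x y} → x ≤ y → y ≤ x → x ≈ y
  ≤-antisym {x} {y} x≤y y≤x = proj₁ (tight x y) λ x#y → [ y≤x , x≤y ]′ (#⇒<⊎> x#y)

  -- Tightness of apartness makes equations stable, which is what lets an optimum known only up to
  -- double negation determine a real number.
  ≈-stable : ∀ {x y} → ¬ ¬ (x ≈ y) → x ≈ y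
  ≈-stable {x} {y} ¬¬x≈y = proj₁ (tight x y) λ x#y → ¬¬x≈y λ x≈y → #-irrefl x≈y x#y

  <⇒0<- : ∀ {x y} → x < y → 0# < y - x
  <⇒0<- {x} x<y = <-respˡ (-‿inverseʳ x) (+-monoˡ-< (- x) x<y)

  0<-⇒< : ∀ {x y} → 0# < y - x → x < y
  0<-⇒< {x} {y} 0<y-x = <-respˡ (+-identityˡ x)
    (<-respʳ (solve 2 (λ x y → y :- x :+ x := y) ≈-refl x y) (+-monoˡ-< x 0<y-x))

  neg-< : ∀ {x} → x < 0# → 0# < - x
  neg-< {x} x<0 = <-respʳ (+-identityˡ (- x)) (<⇒0<- x<0)

  infixl 6 _⊹_
  infixl 7 _⊛_

  -- Cotransitivity compares a negative sum with x: either x is itself negative or the sum lies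
  -- below x, making y negative.
  _⊹_ : ∀ {x y} → 0# ≤ x → 0# ≤ y → 0# ≤ x + y
  _⊹_ {x} {y} 0≤x 0≤y x+y<0 = [ sum<x , 0≤x ]′ (<-cotrans x+y<0 x)
    where
    sum<x : ¬ (x + y < x)
    sum<x sum<x = 0≤y (0<-⇒< (<-respʳ (solve 2 (λ x y → x :- (x :+ y) := con 0ℤ :- y) ≈-refl x y) (<⇒0<- sum<x)))

  -- The conclusion is a negation, so both factors may be compared with 0 classically.
  _⊛_ : ∀ {x y} → 0# ≤ x → 0# ≤ y → 0# ≤ x * y
  _⊛_ {x} {y} 0≤x 0≤y xy<0 = factor≤0 x y xy<0 0≮x 0≤x
    where
    factor≤0 : ∀ x y → x * y < 0# → ¬ (0# < x) → ¬ (0# ≤ x)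
    factor≤0 x y xy<0 0≮x 0≤x = <-irrefl (≈-trans (*-congʳ (≤-antisym 0≮x 0≤x)) (zeroˡ y)) xy<0
    0≮x : ¬ (0# < x)
    0≮x 0<x = factor≤0 y x (<-respˡ (*-comm x y) xy<0)
      (λ 0<y → <-irrefl ≈-refl (<-trans xy<0 (*-pos 0<x 0<y))) 0≤y

  ≤-by : ∀ {x y t} → y - x ≈ t → 0# ≤ t → x ≤ y
  ≤-by eq 0≤t y<x = 0≤t (<-respˡ eq (0<-⇒< (<-respʳ
    (solve 2 (λ x y → x :- y := con 0ℤ :- (y :- x)) ≈-refl _ _) (<⇒0<- y<x))))

  0≤- : ∀ {x y} → x ≤ y → 0# ≤ y - x
  0≤- x≤y y-x<0 = x≤y (0<-⇒< (<-respʳ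
    (solve 2 (λ x y → :- (y :- x) := x :- y) ≈-refl _ _) (neg-< y-x<0)))

  0<1 : 0# < 1#
  0<1 with #⇒<⊎> 1#0
  ... | inj₂ 0<1 = 0<1
  ... | inj₁ 1<0 = <-respʳ
    (≈-trans (solve 1 (λ x → :- x :* :- x := x :* x) ≈-refl 1#) (*-identityˡ 1#))
    (*-pos (neg-< 1<0) (neg-< 1<0))

  0≤fromℕ : ∀ n → 0# ≤ fromℕ n
  0≤fromℕ zero    = ≤-reflexive ≈-refl
  0≤fromℕ (suc n) = <⇒≤ 0<1 ⊹ 0≤fromℕ n

  0<fromℕ : ∀ n → 0# < fromℕ (suc n)
  0<fromℕ n = <-≤-trans 0<1 (≤-by
    (solve 2 (λ x y → x :+ y :- x := y) ≈-refl 1# (fromℕ n)) (0≤fromℕ n))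

  fromℤ-difference : ∀ i j → fromℤ (j ℤ.- i) ≈ fromℤ j - fromℤ i
  fromℤ-difference i j = ≈-trans (fromℤ-+ j (ℤ.- i)) (+-congˡ (fromℤ-- i))

  fromℤ-mono-≤ : ∀ {i j} → i ℤ.≤ j → fromℤ i ≤ fromℤ j
  fromℤ-mono-≤ {i} {j} i≤j = ≤-by (≈-sym (fromℤ-difference i j)) (nonneg (ℤ.i≤j⇒0≤j-i i≤j))
    where
    nonneg : ∀ {k} → 0ℤ ℤ.≤ k → 0# ≤ fromℤ k
    nonneg {+ n} _ = 0≤fromℕ n

  fromℤ-mono-< : ∀ {i j} → i ℤ.< j → fromℤ i < fromℤ j
  fromℤ-mono-< {i} {j} i<j = <-≤-trans
    (0<-⇒< (<-respʳ (≈-trans (≈-reflexive (cong fromℤ (≡.sym (lin i)))) (fromℤ-difference i (1ℤ ℤ.+ i))) (0<fromℕ 0)))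
    (fromℤ-mono-≤ (ℤ.i<j⇒suc[i]≤j i<j))
    where
    lin : ∀ i → 1ℤ ℤ.+ i ℤ.- i ≡ 1ℤ
    lin = solve-∀

  fromℤ-cancel-≤ : ∀ {i j} → fromℤ i ≤ fromℤ j → i ℤ.≤ j
  fromℤ-cancel-≤ i≤j = ℤ.≮⇒≥ λ j<i → i≤j (fromℤ-mono-< j<i)

  fromℤ-cancel-< : ∀ {i j} → fromℤ i < fromℤ j → i ℤ.< j
  fromℤ-cancel-< i<j = ℤ.≰⇒> λ j≤i → fromℤ-mono-≤ j≤i i<j

  inverse : ∀ {x} → 0# < x → ∃[ y ] x * y ≈ 1# × 0# < y
  inverse {x} 0<x with y , _ , eq ← #⇒invertible (#-sym (<⇒# 0<x)) = y , xy≈1 , 0<y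
    where
    -- Apartness yields invertibility of the difference `x - 0#`, not of `x` literally.
    xy≈1 : x * y ≈ 1#
    xy≈1 = ≈-trans (*-congʳ (≈-sym (x-0≈x x))) eq
    y#0 : y # 0#
    y#0 = invertible⇒#
      ( x
      , ≈-trans (*-congˡ (x-0≈x y)) xy≈1
      , ≈-trans (*-congʳ (x-0≈x y)) (≈-trans (*-comm y x) xy≈1))
    0<y : 0# < y
    0<y with #⇒<⊎> y#0
    ... | inj₂ 0<y = 0<y
    -- A negative y would make x (- y) = -1 positive.
    ... | inj₁ y<0 = ⊥-elim (<⇒≤ 0<1 (0<-⇒< (<-respʳ
      (≈-trans (solve 2 (λ x y → x :* :- y := con 0ℤ :- x :* y) ≈-refl x y)
               (+-congˡ (-‿cong xy≈1)))
      (*-pos 0<x (neg-< y<0)))))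

  *-cancelˡ-≤ : ∀ {k x y} → 0# < k → k * x ≤ k * y → x ≤ y
  *-cancelˡ-≤ {k} {x} {y} 0<k kx≤ky y<x = kx≤ky (0<-⇒< (<-respʳ
    (solve 3 (λ k x y → k :* (x :- y) := k :* x :- k :* y) ≈-refl k x y)
    (*-pos 0<k (<⇒0<- y<x))))

-- Support functions of lattice polygons, and two families of triangles.

module Support where
  open import Data.Fin.Base using (Fin; zero; suc)
  open import Data.Integer.Base using (ℤ; +_; -[1+_]; _+_; _*_; _-_; -_; _≤_; 0ℤ; 1ℤ; -1ℤ; +≤+; -≤-)
  import Data.Integer.Properties as ℤ
  open import Data.Integer.Tactic.RingSolver using (solve-∀)
  open import Data.Nat.Base as ℕ using (ℕ; zero; suc; z≤n)
  import Data.Nat.Properties as ℕ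
  open import Data.Product.Base using (_,_; ∃-syntax; proj₁; proj₂; swap)
  open import Function.Base using (_∘_)
  open import Relation.Nullary.Decidable using (yes; no)
  open import Data.Empty using (⊥-elim)
  open import Data.Sum.Base using (inj₁; inj₂)
  open import Data.Vec.Functional using (Vector; tail)
  open import Relation.Binary.PropositionalEquality using (_≡_; sym; cong; subst)
  open SublinearFunctions

  pair : ℤ → ℤ → Vector ℤ 2 → ℤ
  pair p q u = p * u zero + q * u (suc zero)

  minimum : ∀ {n} (f : Vector ℤ (suc n)) → ∃[ i ] (∀ j → f i ≤ f j)
  minimum {zero} f = zero , λ { zero → ℤ.≤-refl }
  minimum {suc n} f with i , fi≤ ← minimum (tail f) with ℤ.≤-total (f zero) (f (suc i))
  ... | inj₁ f0≤fi = zero , λ { zero → ℤ.≤-refl ; (suc j) → ℤ.≤-trans f0≤fi (fi≤ j) }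
  ... | inj₂ fi≤f0 = suc i , λ { zero → fi≤f0 ; (suc j) → fi≤ j }

  module _ {n} (v : Vector (Vector ℤ 2) (suc n)) where

    lowest : ∀ p q → Fin (suc n)
    lowest p q = proj₁ (minimum (λ i → pair p q (v i)))

    lowest-≤ : ∀ p q i → pair p q (v (lowest p q)) ≤ pair p q (v i)
    lowest-≤ p q = proj₂ (minimum (λ i → pair p q (v i)))

    -- The negative of h_P, for P spanned by v.
    support : ℤ → ℤ → ℤ
    support p q = - pair p q (v (lowest p q))

    support-lub : ∀ {c} p q → (∀ i → c ≤ pair p q (v i)) → support p q ≤ - c
    support-lub p q c≤ = ℤ.neg-mono-≤ (c≤ (lowest p q))

    support-upper : ∀ p q i → - pair p q (v i) ≤ support p q
    support-upper p q i = ℤ.neg-mono-≤ (lowest-≤ p q i)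

    -- A maximum of linear functions is sublinear: the vertex optimal for one side of each
    -- inequality is a competitor on the other side.
    support-sublinear : Sublinear support
    support-sublinear = record
      { subadditive = λ p q r s →
          let i = lowest (p + r) (q + s) in ≤-by
          (additive p q r s (v i zero) (v i (suc zero))
            (pair p q (v (lowest p q))) (pair r s (v (lowest r s))))
          (0≤- (lowest-≤ p q i) ⊞ 0≤- (lowest-≤ r s i))
      ; homogeneous = λ k p q →
          let i = lowest (+ k * p) (+ k * q)
              j = lowest p q
          in ℤ.≤-antisym
            (≤-by (scaled₁ (+ k) p q (v i zero) (v i (suc zero)) (v j zero) (v j (suc zero)))
                  (k ⊠ 0≤- (lowest-≤ p q i)))
            (≤-by (scaled₂ (+ k) p q (v i zero) (v i (suc zero)) (v j zero) (v j (suc zero)))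
                  (0≤- (lowest-≤ (+ k * p) (+ k * q) j)))
      }
      where
      additive : ∀ p q r s x y a b → (- a + - b) - (- ((p + r) * x + (q + s) * y))
        ≡ (p * x + q * y - a) + (r * x + s * y - b)
      additive = solve-∀
      scaled₁ : ∀ k p q x y z w →
        k * (- (p * z + q * w)) - (- (k * p * x + k * q * y))
        ≡ k * ((p * x + q * y) - (p * z + q * w))
      scaled₁ = solve-∀
      scaled₂ : ∀ k p q x y z w →
        (- (k * p * x + k * q * y)) - k * (- (p * z + q * w))
        ≡ (k * p * z + k * q * w) - (k * p * x + k * q * y)
      scaled₂ = solve-∀

  vec : ℤ → ℤ → Vector ℤ 2
  vec p q zero    = p
  vec p q (suc _) = q

  rightTriangle : ℕ → ℕ → Vector (Vector ℤ 2) 3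
  rightTriangle m n zero             = vec 0ℤ 0ℤ
  rightTriangle m n (suc zero)       = vec (+ m) 0ℤ
  rightTriangle m n (suc (suc zero)) = vec 0ℤ (+ n)

  module _ (m n : ℕ) where
    private g = support (rightTriangle m n)

    rightTriangle-lub : ∀ {c} p q → c ≤ 0ℤ → c ≤ p * + m → c ≤ q * + n → g p q ≤ - c
    rightTriangle-lub {c} p q c≤0 c≤pm c≤qn = support-lub (rightTriangle m n) p q λ where
        zero             → subst (c ≤_) (origin p q) c≤0
        (suc zero)       → subst (c ≤_) (horizontal p q (+ m)) c≤pm
        (suc (suc zero)) → subst (c ≤_) (vertical p q (+ n)) c≤qn
      where
      origin : ∀ p q → 0ℤ ≡ p * 0ℤ + q * 0ℤ
      origin = solve-∀
      horizontal : ∀ p q m → p * m ≡ p * m + q * 0ℤ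
      horizontal = solve-∀
      vertical : ∀ p q n → q * n ≡ p * 0ℤ + q * n
      vertical = solve-∀

    rightTriangle-0 : ∀ p q → 0ℤ ≤ g p q
    rightTriangle-0 p q = subst (_≤ g p q) (eq p q) (support-upper (rightTriangle m n) p q zero)
      where
      eq : ∀ p q → - (p * 0ℤ + q * 0ℤ) ≡ 0ℤ
      eq = solve-∀

    rightTriangle-x : ∀ p q → 0ℤ ≤ g p q + p * + m
    rightTriangle-x p q = subst (0ℤ ≤_) (eq (g p q) p q (+ m))
      (0≤- (support-upper (rightTriangle m n) p q (suc zero)))
      where
      eq : ∀ g p q m → g - (- (p * m + q * 0ℤ)) ≡ g + p * m
      eq = solve-∀

    rightTriangle-y : ∀ p q → 0ℤ ≤ g p q + q * + n
    rightTriangle-y p q = subst (0ℤ ≤_) (eq (g p q) p q (+ n))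
      (0≤- (support-upper (rightTriangle m n) p q (suc (suc zero))))
      where
      eq : ∀ g p q n → g - (- (p * 0ℤ + q * n)) ≡ g + q * n
      eq = solve-∀

  -- If the smaller number were nonnegative, both would be, and a sum at most 0 would force both to
  -- vanish.
  smaller-negative : ∀ p q → NonZero p q → p ≤ q → p + q ≤ 0ℤ → 0ℤ ≤ -1ℤ - p
  smaller-negative -[1+ m ] q nz p≤q p+q≤0 = 0≤- { -[1+ m ]} { -1ℤ} (-≤- z≤n)
  smaller-negative (+ m) (+ n) nz p≤q (+≤+ m+n≤0) = ⊥-elim (nz
    ( cong +_ (ℕ.m+n≡0⇒m≡0 m (ℕ.n≤0⇒n≡0 m+n≤0))
    , cong +_ (ℕ.m+n≡0⇒n≡0 m (ℕ.n≤0⇒n≡0 m+n≤0))))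

  module _ (k : ℕ) where
    private
      K = + k
      0≤K : 0ℤ ≤ K
      0≤K = +≤+ z≤n
      -K≤0 : - K ≤ 0ℤ
      -K≤0 = ℤ.neg-mono-≤ 0≤K
      0≤1*K : 0ℤ ≤ 1ℤ * K
      0≤1*K = subst (0ℤ ≤_) (sym (ℤ.*-identityˡ K)) 0≤K
      -K≤-1*K : - K ≤ -1ℤ * K
      -K≤-1*K = ℤ.≤-reflexive (sym (ℤ.-1*i≡-i K))

    -- The inner normals of the three sides sum to zero, and `g` is at most 0, 0 and k on them.
    triangle-certificate : Certificate (support (rightTriangle k k)) 3 K
    triangle-certificate = triangular 1ℤ 0ℤ 0ℤ 1ℤ (λ ()) (λ ()) (λ ()) (≤-by
      (lin K (g 1ℤ 0ℤ) (g 0ℤ 1ℤ) (g -1ℤ -1ℤ))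
      (0≤- (rightTriangle-lub k k {0ℤ} 1ℤ 0ℤ ℤ.≤-refl 0≤1*K ℤ.≤-refl)
       ⊞ 0≤- (rightTriangle-lub k k {0ℤ} 0ℤ 1ℤ ℤ.≤-refl ℤ.≤-refl 0≤1*K)
       ⊞ 0≤- (rightTriangle-lub k k { - K} -1ℤ -1ℤ -K≤0 -K≤-1*K -K≤-1*K)))
      where
      g = support (rightTriangle k k)
      lin : ∀ K a b c → K - (a + b + c) ≡ (0ℤ - a) + (0ℤ - b) + (- (- K) - c)
      lin = solve-∀

    -- The point is the centroid (k / 3 , k / 3). The vertex used to bound `g` depends on (p , q):
    -- the origin if p + q ≥ 1, otherwise the vertex on the axis of the smaller coordinate, which is
    -- then negative.
    triangle-feasible : Feasible (support (rightTriangle k k)) 3 K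
    triangle-feasible = K , K , bound
      where
      g = support (rightTriangle k k)
      lin₀ : ∀ g p q K → + 3 * g + (p * K + q * K) - K ≡ + 3 * g + K * (p + q - 1ℤ)
      lin₀ = solve-∀
      lin₁ : ∀ g p q K →
        + 3 * g + (p * K + q * K) - K ≡ + 3 * (g + p * K) + K * ((q - p) + (-1ℤ - p))
      lin₁ = solve-∀
      lin₂ : ∀ g p q K →
        + 3 * g + (p * K + q * K) - K ≡ + 3 * (g + q * K) + K * ((p - q) + (-1ℤ - q))
      lin₂ = solve-∀
      bound : ∀ p q → NonZero p q → K ≤ shift 3 K K g p q
      bound p q nz with 1ℤ ℤ.≤? p + q | ℤ.≤-total p q
      ... | yes 1≤p+q | _ = ≤-by (lin₀ (g p q) p q K)
        (3 ⊠ rightTriangle-0 k k p q ⊞ k ⊠ 0≤- 1≤p+q)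
      ... | no 1≰p+q | inj₁ p≤q = ≤-by (lin₁ (g p q) p q K)
        (3 ⊠ rightTriangle-x k k p q
         ⊞ k ⊠ (0≤- p≤q ⊞ smaller-negative p q nz p≤q (ℤ.i<j⇒i≤pred[j] (ℤ.≰⇒> 1≰p+q))))
      ... | no 1≰p+q | inj₂ q≤p = ≤-by (lin₂ (g p q) p q K)
        (3 ⊠ rightTriangle-y k k p q
         ⊞ k ⊠ (0≤- q≤p ⊞ smaller-negative q p (nz ∘ swap) q≤p
           (subst (_≤ 0ℤ) (ℤ.+-comm p q) (ℤ.i<j⇒i≤pred[j] (ℤ.≰⇒> 1≰p+q)))))

    -- The width in direction e₁ is k.
    halfTriangle-certificate : Certificate (support (rightTriangle k (k ℕ.+ k))) 2 K
    halfTriangle-certificate = antipodal 1ℤ 0ℤ (λ ()) (≤-by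
      (lin K (g 1ℤ 0ℤ) (g -1ℤ 0ℤ))
      (0≤- (rightTriangle-lub k (k ℕ.+ k) {0ℤ} 1ℤ 0ℤ ℤ.≤-refl 0≤1*K ℤ.≤-refl)
       ⊞ 0≤- (rightTriangle-lub k (k ℕ.+ k) { - K} -1ℤ 0ℤ -K≤0 -K≤-1*K -K≤0)))
      where
      g = support (rightTriangle k (k ℕ.+ k))
      lin : ∀ K a b → K - (a + b) ≡ (0ℤ - a) + (- (- K) - b)
      lin = solve-∀

    -- The point is (k / 2 , k / 2). The bound on `g` comes from the origin if p + q ≥ 1, else from
    -- (k , 0) if p < q, and else from (0 , 2 k), where q is negative.
    halfTriangle-feasible : Feasible (support (rightTriangle k (k ℕ.+ k))) 2 K
    halfTriangle-feasible = K , K , bound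
      where
      g = support (rightTriangle k (k ℕ.+ k))
      lin₀ : ∀ g p q K → + 2 * g + (p * K + q * K) - K ≡ + 2 * g + K * (p + q - 1ℤ)
      lin₀ = solve-∀
      lin₁ : ∀ g p q K → + 2 * g + (p * K + q * K) - K ≡ + 2 * (g + p * K) + K * (q - (1ℤ + p))
      lin₁ = solve-∀
      lin₂ : ∀ g p q K → + 2 * g + (p * K + q * K) - K
        ≡ + 2 * (g + q * (K + K)) + K * ((p - q) + + 2 * (-1ℤ - q) + 1ℤ)
      lin₂ = solve-∀
      bound : ∀ p q → NonZero p q → K ≤ shift 2 K K g p q
      bound p q nz with 1ℤ ℤ.≤? p + q | p ℤ.<? q
      ... | yes 1≤p+q | _ = ≤-by (lin₀ (g p q) p q K)
        (2 ⊠ rightTriangle-0 k (k ℕ.+ k) p q ⊞ k ⊠ 0≤- 1≤p+q)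
      ... | no _ | yes p<q = ≤-by (lin₁ (g p q) p q K)
        (2 ⊠ rightTriangle-x k (k ℕ.+ k) p q ⊞ k ⊠ 0≤- (ℤ.i<j⇒suc[i]≤j p<q))
      ... | no 1≰p+q | no p≮q = ≤-by (lin₂ (g p q) p q K)
        (2 ⊠ rightTriangle-y k (k ℕ.+ k) p q
         ⊞ k ⊠ (0≤- (ℤ.≮⇒≥ p≮q)
           ⊞ 2 ⊠ smaller-negative q p (nz ∘ swap) (ℤ.≮⇒≥ p≮q)
                   (subst (_≤ 0ℤ) (ℤ.+-comm p q) (ℤ.i<j⇒i≤pred[j] (ℤ.≰⇒> 1≰p+q)))
           ⊞ +≤+ (z≤n {1})))

-- Fine adjoints of real lattice polygons, and the spectrum.

module LatticePolygon {c ℓ₁ ℓ₂} (ℝ : RealNumbers c ℓ₁ ℓ₂) where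
  open SublinearFunctions
    using (Sublinear; NonZero; Certificate; antipodal; triangular; Feasible; optimum; shift)
  open Support
  open RealNumbers ℝ renaming (zero to *-zero; refl to ≈-refl; sym to ≈-sym; trans to ≈-trans; reflexive to ≈-reflexive)
  open Polytopes ℝ
  open OrderedField ℝ
  open import Algebra.Properties.Monoid.Sum +-monoid using (sum; sum-syntax)
  open import Data.Empty using (⊥-elim)
  open import Data.Fin.Base using (Fin; zero; suc)
  open import Data.Integer.Base as ℤ using (ℤ; +_; 0ℤ; 1ℤ)
  import Data.Integer.Properties as ℤ
  open import Data.Nat.Base as ℕ using (ℕ; zero; suc)
  import Data.Nat.Properties as ℕ
  open import Data.Nat.Divisibility using (_∣_; divides; _∣?_)
  open import Data.Product.Base using (_×_; _,_; ∃; ∃-syntax; proj₁; proj₂; map₂)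
  open import Data.Sum.Base using (_⊎_; inj₁; inj₂)
  open import Data.Vec.Functional using (Vector; tail)
  open import Relation.Binary.PropositionalEquality as ≡ using (_≡_; refl; cong; subst)
  open import Relation.Binary.Structures using (IsStrictPartialOrder)
  open import Relation.Nullary.Decidable using (_⊎-dec_; decidable-stable)
  open import Relation.Nullary.Negation using (¬_)
  open IsStrictPartialOrder <-isStrictPartialOrder using () renaming (irrefl to <-irrefl; trans to <-trans)
  open import Relation.Unary using (Pred; _∈_; _∪_)

  -- The total weight stays as a factor because the weights of a tail no longer sum to 1, so the
  -- induction needs the unnormalised form.
  weighted-≤ : ∀ {n} (w y z : Vector Carrier n) c α β → (∀ i → 0# ≤ w i) →
    (∀ i → c ≤ α * y i + β * z i) →
    c * sum w ≤ α * ∑[ i < n ] (w i * y i) + β * ∑[ i < n ] (w i * z i)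
  weighted-≤ {zero} w y z c α β 0≤w c≤ = ≤-reflexive
    (solve 3 (λ c α β → c :* con 0ℤ := α :* con 0ℤ :+ β :* con 0ℤ) ≈-refl c α β)
  weighted-≤ {suc n} w y z c α β 0≤w c≤ = ≤-by
    (solve 9 (λ w y z c α β W Y Z →
        (α :* (w :* y :+ Y) :+ β :* (w :* z :+ Z)) :- c :* (w :+ W)
        := w :* ((α :* y :+ β :* z) :- c) :+ ((α :* Y :+ β :* Z) :- c :* W))
      ≈-refl (w zero) (y zero) (z zero) c α β (sum (tail w))
      (∑[ i < n ] (tail w i * tail y i)) (∑[ i < n ] (tail w i * tail z i)))
    (0≤w zero ⊛ 0≤- (c≤ zero)
      ⊹ 0≤- (weighted-≤ (tail w) (tail y) (tail z) c α β (λ i → 0≤w (suc i)) (λ i → c≤ (suc i))))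

  δ : ∀ {n} → Fin n → Vector Carrier n
  δ zero    zero    = 1#
  δ zero    (suc j) = 0#
  δ (suc i) zero    = 0#
  δ (suc i) (suc j) = δ i j

  sum-0* : ∀ {n} (y : Vector Carrier n) → ∑[ i < n ] (0# * y i) ≈ 0#
  sum-0* {zero} y = ≈-refl
  sum-0* {suc n} y = ≈-trans (+-cong (zeroˡ _) (sum-0* (tail y))) (+-identityˡ 0#)

  sum-0 : ∀ n → sum {n} (λ _ → 0#) ≈ 0#
  sum-0 zero    = ≈-refl
  sum-0 (suc n) = ≈-trans (+-identityˡ _) (sum-0 n)

  sum-δ* : ∀ {n} (i : Fin n) (y : Vector Carrier n) → ∑[ j < n ] (δ i j * y j) ≈ y i
  sum-δ* zero    y = ≈-trans (+-cong (*-identityˡ _) (sum-0* (tail y))) (+-identityʳ _)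
  sum-δ* (suc i) y = ≈-trans (+-cong (zeroˡ _) (sum-δ* i (tail y))) (+-identityˡ _)

  sum-δ : ∀ {n} (i : Fin n) → sum (δ i) ≈ 1#
  sum-δ {suc n} zero    = ≈-trans (+-congˡ (sum-0 n)) (+-identityʳ 1#)
  sum-δ {suc n} (suc i) = ≈-trans (+-identityˡ _) (sum-δ i)

  0≤δ : ∀ {n} (i j : Fin n) → 0# ≤ δ i j
  0≤δ zero    zero    = <⇒≤ 0<1
  0≤δ zero    (suc j) = ≤-reflexive ≈-refl
  0≤δ (suc i) zero    = ≤-reflexive ≈-refl
  0≤δ (suc i) (suc j) = 0≤δ i j

  generator∈conv : ∀ {d n} (p : Vector (Point d) n) i → conv p (p i)
  generator∈conv p i = δ i , 0≤δ i , sum-δ i , λ j → ≈-sym (sum-δ* i (λ k → p k j))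

  neg-nonZero : ∀ {p q} → NonZero p q → NonZero (ℤ.- p) (ℤ.- q)
  neg-nonZero nz (-p≡0 , -q≡0) = nz (ℤ.neg-injective -p≡0 , ℤ.neg-injective -q≡0)

  vec-nonZero : ∀ {p q} → NonZero p q → IsNonZero (vec p q)
  vec-nonZero nz all0 = nz (all0 zero , all0 (suc zero))

  nonZero-components : ∀ {a : Vector ℤ 2} → IsNonZero a → NonZero (a zero) (a (suc zero))
  nonZero-components nz (a₀≡0 , a₁≡0) = nz λ { zero → a₀≡0 ; (suc zero) → a₁≡0 }

  fromℤ-pair : ∀ (a u : Vector ℤ 2) →
    ⟨ a , (λ j → fromℤ (u j)) ⟩ ≈ fromℤ (pair (a zero) (a (suc zero)) u)
  fromℤ-pair a u = ≈-sym (≈-trans (fromℤ-+ (a zero ℤ.* u zero) (a (suc zero) ℤ.* u (suc zero))) (≈-trans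
    (+-cong (fromℤ-* (a zero) (u zero)) (fromℤ-* (a (suc zero)) (u (suc zero))))
    (+-congˡ (≈-sym (+-identityʳ _)))))

  module _ {n} (v : Vector (Vector ℤ 2) (suc n)) where
    P = latticePolytope v
    g = support v

    support-≤ : ∀ a {x} → x ∈ P → fromℤ (ℤ.- g (a zero) (a (suc zero))) ≤ ⟨ a , x ⟩
    support-≤ a {x} (w , 0≤w , Σw≈1 , x≈) = ≤-trans
      (≤-reflexive (≈-trans (≈-sym (*-identityʳ h)) (*-congˡ (≈-sym Σw≈1))))
      (≤-trans
        (weighted-≤ w (λ i → fromℤ (v i zero)) (λ i → fromℤ (v i (suc zero))) h
          (fromℤ (a zero)) (fromℤ (a (suc zero))) 0≤w λ i →
          ≤-trans (fromℤ-mono-≤ (subst (ℤ._≤ pair (a zero) (a (suc zero)) (v i))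
                    (≡.sym (ℤ.neg-involutive (pair (a zero) (a (suc zero)) (v (lowest v (a zero) (a (suc zero)))))))
                    (lowest-≤ v (a zero) (a (suc zero)) i)))
                  (≤-reflexive (≈-trans (≈-sym (fromℤ-pair a (v i))) (+-congˡ (+-identityʳ _)))))
        (≤-reflexive (+-cong (*-congˡ (≈-sym (x≈ zero)))
          (≈-trans (*-congˡ (≈-sym (x≈ (suc zero)))) (≈-sym (+-identityʳ _))))))
      where h = fromℤ (ℤ.- g (a zero) (a (suc zero)))

    isSupportValue : ∀ a → IsSupportValue P a (fromℤ (ℤ.- g (a zero) (a (suc zero))))
    isSupportValue a =
        ( (λ j → fromℤ (v i j)) , generator∈conv (λ i j → fromℤ (v i j)) i
        , ≈-trans (fromℤ-pair a (v i)) (≈-reflexive (cong fromℤ (≡.sym (ℤ.neg-involutive (pair (a zero) (a (suc zero)) (v i)))))))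
      , λ x → support-≤ a {x}
      where i = lowest v (a zero) (a (suc zero))

    -- The value h in the definition of the adjoint is attained at a point of `P`, hence is at least
    -- - g. The parameters α and β let callers present `fromℤ (- p)` as `- fromℤ p`, so that linear
    -- terms cancel in the ring solver.
    fineAdjoint-≤ : ∀ {s x} → x ∈ fineAdjoint P s → ∀ p q → NonZero p q →
      ∀ {α β} → fromℤ p ≈ α → fromℤ q ≈ β →
      s ≤ α * x zero + β * x (suc zero) + fromℤ (g p q)
    fineAdjoint-≤ {s} {x} x∈ p q nz {α} {β} p≈α q≈β
      with h , ((y , y∈P , y≈h) , _) , h+s≤ ← x∈ (vec p q) (vec-nonZero nz) = ≤-by
      (≈-trans
        (+-congʳ (+-congʳ (+-cong (*-congʳ (≈-sym p≈α)) (*-congʳ (≈-sym q≈β)))))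
      (≈-trans
        (solve 5 (λ s h a b g → (a :+ b :+ g) :- s := (a :+ (b :+ con 0ℤ) :- (h :+ s)) :+ (h :- :- g)) ≈-refl
          s h (fromℤ p * x zero) (fromℤ q * x (suc zero)) (fromℤ (g p q)))
        (+-congˡ (+-cong (≈-sym y≈h) (-‿cong (≈-sym (fromℤ-- (g p q))))))))
      (0≤- h+s≤ ⊹ 0≤- (support-≤ (vec p q) {y} y∈P))

    certificate-≤ : ∀ {k T} → Certificate g k T → ∀ {s x} → x ∈ fineAdjoint P s →
      fromℕ k * s ≤ fromℤ T
    certificate-≤ (antipodal {T} p q nz sum≤T) {s} {x} x∈ = ≤-by
      (solve 8 (λ T s p q x y a b →
          T :- con (+ 2) :* s
          := (p :* x :+ q :* y :+ a :- s) :+ ((:- p) :* x :+ (:- q) :* y :+ b :- s) :+ (T :- (a :+ b)))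
        ≈-refl (fromℤ T) s (fromℤ p) (fromℤ q) (x zero) (x (suc zero))
        (fromℤ (g p q)) (fromℤ (g (ℤ.- p) (ℤ.- q))))
      (0≤- (fineAdjoint-≤ {x = x} x∈ p q nz ≈-refl ≈-refl)
        ⊹ 0≤- (fineAdjoint-≤ {x = x} x∈ (ℤ.- p) (ℤ.- q) (neg-nonZero nz) (fromℤ-- p) (fromℤ-- q))
        ⊹ 0≤- (≤-trans (≤-reflexive (≈-sym (fromℤ-+ (g p q) (g (ℤ.- p) (ℤ.- q))))) (fromℤ-mono-≤ sum≤T)))
    certificate-≤ (triangular {T} p q r t nz nz′ nz″ sum≤T) {s} {x} x∈ = ≤-by
      (solve 11 (λ T s p q r t x y a b d →
          T :- con (+ 3) :* s
          := (p :* x :+ q :* y :+ a :- s) :+ (r :* x :+ t :* y :+ b :- s)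
             :+ ((:- (p :+ r)) :* x :+ (:- (q :+ t)) :* y :+ d :- s) :+ (T :- (a :+ b :+ d)))
        ≈-refl (fromℤ T) s (fromℤ p) (fromℤ q) (fromℤ r) (fromℤ t) (x zero) (x (suc zero))
        (fromℤ (g p q)) (fromℤ (g r t)) (fromℤ (g -p-r -q-t)))
      (0≤- (fineAdjoint-≤ {x = x} x∈ p q nz ≈-refl ≈-refl)
        ⊹ 0≤- (fineAdjoint-≤ {x = x} x∈ r t nz′ ≈-refl ≈-refl)
        ⊹ 0≤- (fineAdjoint-≤ {x = x} x∈ -p-r -q-t nz″ (fromℤ-neg-sum p r) (fromℤ-neg-sum q t))
        ⊹ 0≤- (≤-trans (≤-reflexive (≈-sym sum≈)) (fromℤ-mono-≤ sum≤T)))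
      where
      -p-r = ℤ.- (p ℤ.+ r)
      -q-t = ℤ.- (q ℤ.+ t)
      fromℤ-neg-sum : ∀ i j → fromℤ (ℤ.- (i ℤ.+ j)) ≈ - (fromℤ i + fromℤ j)
      fromℤ-neg-sum i j = ≈-trans (fromℤ-- (i ℤ.+ j)) (-‿cong (fromℤ-+ i j))
      sum≈ : fromℤ (g p q ℤ.+ g r t ℤ.+ g -p-r -q-t) ≈ fromℤ (g p q) + fromℤ (g r t) + fromℤ (g -p-r -q-t)
      sum≈ = ≈-trans (fromℤ-+ (g p q ℤ.+ g r t) (g -p-r -q-t)) (+-congʳ (fromℤ-+ (g p q) (g r t)))

    -- With κ = 1 / k, multiplying the required inequality by k gives back the integral one.
    feasible⇒fineAdjoint : ∀ k {T} → Feasible g k T → ∀ {κ} → fromℕ k * κ ≈ 1# → 0# < fromℕ k →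
      ∃ (fineAdjoint P (fromℤ T * κ))
    feasible⇒fineAdjoint k {T} (X , Y , T≤) {κ} kκ≈1 0<k = x , λ a nz →
      let p = a zero
          q = a (suc zero)
          h = fromℤ (ℤ.- g p q)
      in h , isSupportValue a , *-cancelˡ-≤ 0<k (≤-by
        (≈-trans
          (solve 8 (λ k κ h T p q X Y →
              k :* (p :* (X :* κ) :+ (q :* (Y :* κ) :+ con 0ℤ)) :- k :* (h :+ T :* κ)
              := (k :* κ) :* (p :* X :+ q :* Y :- T) :- k :* h)
            ≈-refl (fromℕ k) κ h (fromℤ T) (fromℤ p) (fromℤ q) (fromℤ X) (fromℤ Y))
        (≈-trans
          (+-cong (≈-trans (*-congʳ kκ≈1) (*-identityˡ _)) (-‿cong (*-congˡ (fromℤ-- (g p q)))))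
          (≈-trans
            (solve 7 (λ k g T p q X Y →
              (p :* X :+ q :* Y :- T) :- k :* :- g := (k :* g :+ (p :* X :+ q :* Y)) :- T)
              ≈-refl (fromℕ k) (fromℤ (g p q)) (fromℤ T) (fromℤ p) (fromℤ q) (fromℤ X) (fromℤ Y))
            (+-congʳ (≈-sym (fromℤ-shift p q))))))
        (0≤- (fromℤ-mono-≤ (T≤ p q (nonZero-components nz)))))
      where
      x : Point 2
      x zero    = fromℤ X * κ
      x (suc _) = fromℤ Y * κ
      fromℤ-shift : ∀ p q → fromℤ (shift k X Y g p q)
        ≈ fromℕ k * fromℤ (g p q) + (fromℤ p * fromℤ X + fromℤ q * fromℤ Y)
      fromℤ-shift p q = ≈-trans (fromℤ-+ (+ k ℤ.* g p q) (p ℤ.* X ℤ.+ q ℤ.* Y)) (+-cong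
        (fromℤ-* (+ k) (g p q))
        (≈-trans (fromℤ-+ (p ℤ.* X) (q ℤ.* Y)) (+-cong (fromℤ-* p X) (fromℤ-* q Y))))

  -- The supremum and its value.

  FineParameter : ∀ {ℓ} {d} → Pred (Point d) ℓ → Pred Carrier _
  FineParameter P s = 0# < s × ∃ (fineAdjoint P s)

  -- For an empty set σ - 1 would also be an upper bound, below the least one.
  supremum-inhabited : ∀ {ℓ} {A : Pred Carrier ℓ} {σ} → IsSupremum A σ → ¬ ¬ (∃[ s ] s ∈ A)
  supremum-inhabited {σ = σ} (_ , least) empty =
    least (σ - 1#) (λ s s∈A → ⊥-elim (empty (s , s∈A)))
      (0<-⇒< (<-respʳ (solve 2 (λ σ x → x := σ :- (σ :- x)) ≈-refl σ 1#) 0<1))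

  module _ {n} (v : Vector (Vector ℤ 2) (suc n)) {k T}
           (certificate : Certificate (support v) (suc k) T) (feasible : Feasible (support v) (suc k) T) where

    private
      K = fromℕ (suc k)
      0<K = 0<fromℕ k
      κ = proj₁ (inverse 0<K)
      Kκ≈1 = proj₁ (proj₂ (inverse 0<K))
      0<κ = proj₂ (proj₂ (inverse 0<K))

      cancel : ∀ t → K * (t * κ) ≈ t
      cancel t = ≈-trans (solve 3 (λ K t κ → K :* (t :* κ) := t :* (K :* κ)) ≈-refl K t κ)
        (≈-trans (*-congˡ Kκ≈1) (*-identityʳ t))

      A = FineParameter (latticePolytope v)

      bound : ∀ s → s ∈ A → K * s ≤ fromℤ T
      bound s (0<s , x , x∈) = certificate-≤ v certificate {x = x} x∈

      bound/K : ∀ s → s ∈ A → s ≤ fromℤ T * κ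
      bound/K s s∈A = *-cancelˡ-≤ 0<K (≤-trans (bound s s∈A) (≤-reflexive (≈-sym (cancel (fromℤ T)))))

      attained : 0# < fromℤ T → fromℤ T * κ ∈ A
      attained 0<T = *-pos 0<T 0<κ , feasible⇒fineAdjoint v (suc k) feasible Kκ≈1 0<K

    -- The certificate bounds every parameter by T / K, and the feasible point attains this once T >
    -- 0. Positivity of T follows from any one parameter; one exists only up to double negation,
    -- which suffices for an equation.
    supremum-value : ∀ {σ} → IsSupremum A σ → K * σ ≈ fromℤ T
    supremum-value {σ} sup@(upper , least) = ≈-stable λ Kσ≉T →
      supremum-inhabited sup λ (s , s∈A) →
      let 0<T = <-≤-trans (*-pos 0<K (proj₁ s∈A)) (bound s s∈A) in
      Kσ≉T (≈-trans (*-congˡ (≤-antisym (least _ bound/K) (upper _ (attained 0<T)))) (cancel (fromℤ T)))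

    supremum-exists : 0# < fromℤ T → IsSupremum A (fromℤ T * κ) × K * (fromℤ T * κ) ≈ fromℤ T
    supremum-exists 0<T = (bound/K , λ u u≥ → u≥ _ (attained 0<T)) , cancel (fromℤ T)

  *-cancelˡ-≈ : ∀ {k x y} → 0# < k → k * x ≈ k * y → x ≈ y
  *-cancelˡ-≈ 0<k kx≈ky = ≤-antisym
    (*-cancelˡ-≤ 0<k (≤-reflexive kx≈ky)) (*-cancelˡ-≤ 0<k (≤-reflexive (≈-sym kx≈ky)))

  positiveFraction : ∀ {μ σ} → μ * σ ≈ 1# → ∀ m n → fromℕ (suc m) * σ ≈ fromℕ n →
    μ ∈ PositiveFractions (suc m)
  positiveFraction {μ} {σ} μσ≈1 m n mσ≈n = n , 0<n n mσ≈n , μn≈m n mσ≈n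
    where
    μn≈m : ∀ n → fromℕ (suc m) * σ ≈ fromℕ n → μ * fromℕ n ≈ fromℕ (suc m)
    μn≈m n mσ≈n = ≈-trans (*-congˡ (≈-sym mσ≈n))
      (≈-trans (solve 3 (λ μ m σ → μ :* (m :* σ) := m :* (μ :* σ)) ≈-refl μ (fromℕ (suc m)) σ)
      (≈-trans (*-congˡ μσ≈1) (*-identityʳ _)))
    0<n : ∀ n → fromℕ (suc m) * σ ≈ fromℕ n → 0 ℕ.< n
    0<n (suc n) _ = ℕ.z<s
    0<n zero mσ≈0 = ⊥-elim (<-irrefl (≈-trans (≈-sym (zeroʳ μ)) (μn≈m zero mσ≈0)) (0<fromℕ m))

  -- A number only known to be not not an integer can still be rounded constructively.
  round : ∀ {x} → 0# ≤ x → ∃[ n ] (∀ m → x ≈ fromℤ m → m ≡ + n)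
  round {x} 0≤x with N , x<N ← archimedean x =
    search N λ m x≈m → fromℤ-cancel-≤ (≤-trans (≤-reflexive (≈-sym x≈m)) (<⇒≤ x<N))
    where
    search : ∀ N → (∀ m → x ≈ fromℤ m → m ℤ.≤ + N) → ∃[ n ] (∀ m → x ≈ fromℤ m → m ≡ + n)
    search zero m≤0 = zero , λ m x≈m → ℤ.≤-antisym (m≤0 m x≈m)
      (fromℤ-cancel-≤ (≤-trans 0≤x (≤-reflexive x≈m)))
    -- If N < x, an integer equal to x must be N + 1; if x < N + 1, it is at most N and the search
    -- descends.
    search (suc N) m≤1+N with <-cotrans (fromℤ-mono-< {+ N} {+ suc N} (ℤ.+<+ (ℕ.n<1+n N))) x
    ... | inj₁ N<x = suc N , λ m x≈m → ℤ.≤-antisym (m≤1+N m x≈m)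
      (ℤ.i<j⇒suc[i]≤j (fromℤ-cancel-< {+ N} {m} (<-respʳ x≈m N<x)))
    ... | inj₂ x<1+N = search N λ m x≈m →
      ℤ.i<j⇒i≤pred[j] (fromℤ-cancel-< {m} {+ suc N} (<-respˡ x≈m x<1+N))

  -- By `optimum`, 6 σ is a multiple of 2 or of 3, up to double negation. Rounding fixes a natural
  -- number N beforehand; both 6 σ ≈ N and the decidable divisibility of N are stable, so the double
  -- negation disappears.
  spectrum⊆ : ∀ {μ} → μ ∈ FineSpectrum 2 → μ ∈ PositiveFractions 2 ∪ PositiveFractions 3
  -- An empty family spans the empty set, where no support value is attained: its weights would
  -- satisfy `0# ≈ 1#`.
  spectrum⊆ (zero , v , _ , σ , sup , _) = ⊥-elim (supremum-inhabited sup noParameter)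
    where
    noParameter : ¬ (∃ (FineParameter (latticePolytope v)))
    noParameter (s , _ , x , x∈) with _ , ((_ , (_ , _ , 0≈1 , _) , _) , _) , _ ← x∈ (vec 1ℤ 0ℤ) (vec-nonZero λ ())
      = <-irrefl 0≈1 0<1
  spectrum⊆ {μ} (suc n , v , _ , σ , sup , μσ≈1) = conclude (decidable-stable (2 ∣? N ⊎-dec 3 ∣? N)
      λ ¬div → integral λ (_ , div) → ¬div div)
    where
    0≤σ : 0# ≤ σ
    0≤σ σ<0 = supremum-inhabited sup λ (s , 0<s , s∈) → proj₁ sup s (0<s , s∈) (<-trans σ<0 0<s)
    N = proj₁ (round (0≤fromℕ 6 ⊛ 0≤σ))
    6σ≈⇒≡N = proj₂ (round (0≤fromℕ 6 ⊛ 0≤σ))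
    multiple : ∀ a b T → fromℕ 6 ≈ fromℕ a * fromℕ b → fromℕ b * σ ≈ fromℤ T →
      fromℕ 6 * σ ≈ fromℕ N × a ∣ N
    multiple a b T 6≈ab bσ≈T = ≈-trans 6σ≈aT (≈-reflexive (cong fromℤ aT≡N)) , divides ℤ.∣ T ∣
      (≡.trans (≡.sym (cong ℤ.∣_∣ aT≡N)) (≡.trans (ℤ.abs-* (+ a) T) (ℕ.*-comm a ℤ.∣ T ∣)))
      where
      6σ≈aT : fromℕ 6 * σ ≈ fromℤ (+ a ℤ.* T)
      6σ≈aT = ≈-trans (*-congʳ 6≈ab) (≈-trans (*-assoc _ _ _) (≈-trans (*-congˡ bσ≈T)
        (≈-sym (fromℤ-* (+ a) T))))
      aT≡N = 6σ≈⇒≡N (+ a ℤ.* T) 6σ≈aT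
    fromℕ-* : ∀ a b → fromℕ (a ℕ.* b) ≈ fromℕ a * fromℕ b
    fromℕ-* a b = ≈-trans (≈-reflexive (cong fromℤ (ℤ.pos-* a b))) (fromℤ-* (+ a) (+ b))
    integral : ¬ ¬ (fromℕ 6 * σ ≈ fromℕ N × (2 ∣ N ⊎ 3 ∣ N))
    integral none = optimum (support-sublinear v) λ where
      -- Certificates exist only for k = 2 and k = 3; then 6 σ is 3 T or 2 T respectively.
      (2 , T , cert , feas) → none (map₂ inj₂ (multiple 3 2 T (fromℕ-* 3 2) (supremum-value v cert feas sup)))
      (3 , T , cert , feas) → none (map₂ inj₁ (multiple 2 3 T (fromℕ-* 2 3) (supremum-value v cert feas sup)))
    6σ≈N : fromℕ 6 * σ ≈ fromℕ N
    6σ≈N = ≈-stable λ ¬6σ≈N → integral λ (6σ≈N , _) → ¬6σ≈N 6σ≈N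
    quotient : ∀ a b q → fromℕ 6 ≈ fromℕ (suc a) * fromℕ b → N ≡ q ℕ.* suc a → fromℕ b * σ ≈ fromℕ q
    quotient a b q 6≈ab N≡qa = *-cancelˡ-≈ (0<fromℕ a) (≈-trans (≈-sym (*-assoc _ _ _))
      (≈-trans (*-congʳ (≈-sym 6≈ab)) (≈-trans 6σ≈N (≈-trans (≈-reflexive (cong fromℕ N≡qa))
      (≈-trans (fromℕ-* q (suc a)) (*-comm _ _))))))
    conclude : 2 ∣ N ⊎ 3 ∣ N → μ ∈ PositiveFractions 2 ∪ PositiveFractions 3
    -- N = 2 q means 3 σ = q, so μ = 3 / q; likewise N = 3 q gives μ = 2 / q.
    conclude (inj₁ (divides q N≡)) = inj₂ (positiveFraction μσ≈1 2 q (quotient 1 3 q (fromℕ-* 2 3) N≡))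
    conclude (inj₂ (divides q N≡)) = inj₁ (positiveFraction μσ≈1 1 q (quotient 2 2 q (fromℕ-* 3 2) N≡))

  -- The weights are the barycentric coordinates with respect to the three vertices.
  rightTriangle-fullDimensional : ∀ m n →
    FullDimensional (latticePolytope (rightTriangle (suc m) (suc n)))
  rightTriangle-fullDimensional m n x =
    3 , p , generator∈conv p , w , weights≈1 , λ { zero → first ; (suc zero) → second }
    where
    p : Vector (Point 2) 3
    p i j = fromℤ (rightTriangle (suc m) (suc n) i j)
    M = fromℕ (suc m)
    N = fromℕ (suc n)
    M⁻¹ = proj₁ (inverse (0<fromℕ m))
    N⁻¹ = proj₁ (inverse (0<fromℕ n))
    MM⁻¹≈1 = proj₁ (proj₂ (inverse (0<fromℕ m)))
    NN⁻¹≈1 = proj₁ (proj₂ (inverse (0<fromℕ n)))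
    α = x zero * M⁻¹
    β = x (suc zero) * N⁻¹
    w : Vector Carrier 3
    w zero             = 1# - α - β
    w (suc zero)       = α
    w (suc (suc zero)) = β
    weights≈1 : sum w ≈ 1#
    weights≈1 = solve 3 (λ e α β → (e :- α :- β) :+ (α :+ (β :+ con 0ℤ)) := e) ≈-refl 1# α β
    coordinate : ∀ y {k l} → k * l ≈ 1# → y ≈ (y * l) * k
    coordinate y {k} {l} kl≈1 = ≈-trans (≈-sym (*-identityʳ y)) (≈-trans (*-congˡ (≈-sym kl≈1))
      (solve 3 (λ y k l → y :* (k :* l) := (y :* l) :* k) ≈-refl y k l))
    first : x zero ≈ ∑[ i < 3 ] (w i * p i zero)
    first = ≈-trans (coordinate (x zero) MM⁻¹≈1)
      (solve 4 (λ a α β k → α :* k := a :* con 0ℤ :+ (α :* k :+ (β :* con 0ℤ :+ con 0ℤ)))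
        ≈-refl (w zero) α β M)
    second : x (suc zero) ≈ ∑[ i < 3 ] (w i * p i (suc zero))
    second = ≈-trans (coordinate (x (suc zero)) NN⁻¹≈1)
      (solve 4 (λ a α β k → β :* k := a :* con 0ℤ :+ (α :* con 0ℤ :+ (β :* k :+ con 0ℤ)))
        ≈-refl (w zero) α β N)

  triangle∈spectrum : ∀ m n k l → Certificate (support (rightTriangle (suc m) (suc n))) (suc l) (+ suc k) →
    Feasible (support (rightTriangle (suc m) (suc n))) (suc l) (+ suc k) →
    ∀ {μ} → μ * fromℕ (suc k) ≈ fromℕ (suc l) → μ ∈ FineSpectrum 2
  triangle∈spectrum m n k l cert feas {μ} μk≈l =
    3 , v , rightTriangle-fullDimensional m n , _ , proj₁ sup ,
    *-cancelˡ-≈ (0<fromℕ l)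
      (≈-trans (solve 3 (λ l μ σ → l :* (μ :* σ) := μ :* (l :* σ)) ≈-refl (fromℕ (suc l)) μ _)
      (≈-trans (*-congˡ (proj₂ sup)) (≈-trans μk≈l (≈-sym (*-identityʳ _)))))
    where
    v = rightTriangle (suc m) (suc n)
    sup = supremum-exists v cert feas (0<fromℕ k)

  ⊆spectrum : ∀ {μ} → μ ∈ PositiveFractions 2 ∪ PositiveFractions 3 → μ ∈ FineSpectrum 2
  -- Leg lengths are passed as predecessors: `suc (k + suc k)` is `suc k + suc k`, twice the other
  -- leg.
  ⊆spectrum (inj₁ (suc k , _ , μk≈2)) = triangle∈spectrum k (k ℕ.+ suc k) k 1
    (halfTriangle-certificate (suc k)) (halfTriangle-feasible (suc k)) μk≈2
  ⊆spectrum (inj₂ (suc k , _ , μk≈3)) = triangle∈spectrum k k k 2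
    (triangle-certificate (suc k)) (triangle-feasible (suc k)) μk≈3

mainTheorem6 : ∀ {c ℓ₁ ℓ₂ : Level} (ℝ : RealNumbers c ℓ₁ ℓ₂) →
    let open Polytopes ℝ in
    FineSpectrum 2 ≐ (PositiveFractions 2 ∪ PositiveFractions 3)
mainTheorem6 ℝ = spectrum⊆ , ⊆spectrum
  where
  open import Data.Product.Base using (_,_)
  open LatticePolygon ℝ
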